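{- There is an absolute constant $c>0$ such that the following holds for every integer $n$ and every $\varepsilon\in[2/n,1/2]$. Suppose $\mathrm{sk}(\cdot)$ is a sketching algorithm that outputs at most $s=s(n,\varepsilon)$ bits and $\mathrm{est}$ is an estimation algorithm such that together, for every $n$-vertex (unweighted) graph $G=(V,E)$, $$\forall S\subset V,\qquad \Pr\big[\mathrm{est}(S,\mathrm{sk}(G))\in(1\pm\varepsilon)\cdot|\partial(S,\bar S)|\big]\ge 9/10 .$$ Then $s\ge c\,n/\varepsilon$.
   Context: Graphs are undirected. $\bar S=V\setminus S$ and $\partial(S,\bar S)=\{(u,v)\in E: u\in S, v\in\bar S\}$. The sketching algorithm is a (possibly randomized) map from graphs on a fixed vertex set of size $n$ to bit strings; the estimation algorithm sees only the query $S$ and the sketch (no other access to $G$). The probability is over the randomness of the two algorithms, which may be shared. $X\in(1\pm\varepsilon)Y$ means $(1-\varepsilon)Y\le X\le(1+\varepsilon)Y$. -}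

module Defs where

open import Algebra.Bundles using (CommutativeRing)
import Algebra.Definitions.RawMonoid as RawMonoidOps
open import Data.Bool using (Bool; true; false)
import Data.Bool as Bool
open import Data.Fin using (Fin)
open import Data.Fin.Subset as Subset using (Subset)
open import Data.List using (List; length; filter; allFin; cartesianProduct)
open import Data.Nat using (ℕ)
open import Data.Fin.Subset.Properties using (_∈?_)
open import Data.Product using (Σ-syntax; _×_; _,_)
open import Level using (Level; _⊔_; suc)
open import Relation.Binary using (Rel; IsDecTotalOrder)
import Relation.Binary.Construct.NonStrictToStrict as Strict
open import Relation.Binary.PropositionalEquality using (_≡_)
open import Relation.Nullary using (¬_)
open import Relation.Nullary.Decidable using (_×-dec_)
open import Relation.Unary using (Pred; Universal; _≐_; _⊥_; _∪_; _∩_; ∁)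

-- The standard library has no real numbers.  Real quantities live in an
-- arbitrary ordered field; the real numbers of classical mathematics are one
-- (their order is decidable by excluded middle).  No completeness or
-- Archimedean axiom is imposed.
record OrderedField c ℓ₁ ℓ₂ : Set (suc (c ⊔ ℓ₁ ⊔ ℓ₂)) where
  infix  4 _≤_ _<_ _∈[1±_]_
  infixl 7 _/_
  infix  9 _⁻¹

  field
    commutativeRing : CommutativeRing c ℓ₁

  open CommutativeRing commutativeRing public

  field
    _≤_             : Rel Carrier ℓ₂
    isDecTotalOrder : IsDecTotalOrder _≈_ _≤_
    +-monoˡ-≤       : ∀ z {x y} → x ≤ y → x + z ≤ y + z
    *-nonNegative   : ∀ {x y} → 0# ≤ x → 0# ≤ y → 0# ≤ x * y
    0≉1             : ¬ (0# ≈ 1#)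
    -- Total, as in x / 0; its value at 0 is unconstrained.
    _⁻¹             : Carrier → Carrier
    ⁻¹-cong         : ∀ {x y} → x ≈ y → x ⁻¹ ≈ y ⁻¹
    *-inverseʳ      : ∀ {x} → ¬ (x ≈ 0#) → x * x ⁻¹ ≈ 1#

  _<_ : Rel Carrier (ℓ₁ ⊔ ℓ₂)
  _<_ = Strict._<_ _≈_ _≤_

  _/_ : Carrier → Carrier → Carrier
  x / y = x * y ⁻¹

  fromℕ : ℕ → Carrier
  fromℕ k = RawMonoidOps._×_ +-rawMonoid k 1#

  _∈[1±_]_ : Carrier → Carrier → Carrier → Set ℓ₂
  x ∈[1± ε ] y = (1# - ε) * y ≤ x × x ≤ (1# + ε) * y

-- Only an algebra of events and finite additivity are required, so that every
-- (countably additive) probability space is in particular one of these.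
-- Probabilities are attached to measurable predicates; Pr-cong makes them
-- depend neither on the measurability proof nor on the presentation of the
-- event.
record ProbabilitySpace {c ℓ₁ ℓ₂} (F : OrderedField c ℓ₁ ℓ₂) (o m : Level)
       : Set (c ⊔ ℓ₁ ⊔ suc (ℓ₂ ⊔ o ⊔ m)) where
  open OrderedField F

  field
    Ω            : Set o
    Measurable   : Pred Ω ℓ₂ → Set m
    measurable-≐ : ∀ {A B} → A ≐ B → Measurable A → Measurable B
    measurable-U : ∀ {A} → Universal A → Measurable A
    measurable-∁ : ∀ {A} → Measurable A → Measurable (∁ A)
    measurable-∩ : ∀ {A B} → Measurable A → Measurable B → Measurable (A ∩ B)
    measurable-∪ : ∀ {A B} → Measurable A → Measurable B → Measurable (A ∪ B)

    Pr             : ∀ {A} → Measurable A → Carrier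
    Pr-cong        : ∀ {A B} → A ≐ B → (a : Measurable A) (b : Measurable B) →
                     Pr a ≈ Pr b
    Pr-nonNegative : ∀ {A} (a : Measurable A) → 0# ≤ Pr a
    Pr-U           : ∀ {A} → Universal A → (a : Measurable A) → Pr a ≈ 1#
    Pr-additive    : ∀ {A B} → A ⊥ B → (a : Measurable A) (b : Measurable B) →
                     (ab : Measurable (A ∪ B)) → Pr ab ≈ Pr a + Pr b

  Pr[_]≥_ : Pred Ω ℓ₂ → Carrier → Set (m ⊔ ℓ₂)
  Pr[ A ]≥ p = Σ[ a ∈ Measurable A ] p ≤ Pr a

record Graph (n : ℕ) : Set where
  field
    adjacent    : Fin n → Fin n → Bool
    symmetric   : ∀ u v → adjacent u v ≡ adjacent v u
    irreflexive : ∀ v → adjacent v v ≡ false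

module _ {n : ℕ} (G : Graph n) where
  open Graph G

  -- For disjoint S and T, each undirected edge between them is listed exactly
  -- once, oriented from S to T.
  ∂ : (S T : Subset n) → List (Fin n × Fin n)
  ∂ S T = filter (λ (u , v) → (u ∈? S) ×-dec (v ∈? T) ×-dec (adjacent u v Bool.≟ true))
                 (cartesianProduct (allFin n) (allFin n))

  cutSize : Subset n → ℕ
  cutSize S = length (∂ S (Subset.∁ S))

{-# OPTIONS --safe #-}
module Submission where

-- Take k ≈ 1/(4ε) and a bipartite graph of maximum degree k, each of whose ≈ nk potential edges
-- is switched on or off by one bit.  For a potential edge uv,
-- |∂{u}| + |∂{v}| − |∂{u,v}| is twice its bit, and the three estimates together err by at most about
-- 4kε ≤ 1, so thresholding e₁ + e₂ − e₃ at 1 recovers the bit.  By averaging, some outcome ω recovers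
-- at least 7/10 of all (string, bit) pairs.  For a fixed ω this is a deterministic code: as 2^agreement
-- summed over all x ∈ {0,1}^N is 3^N for each decoded string, M messages give
-- ∑ₓ 2^agreement ≤ M 3^N, while convexity bounds the sum below by about 2^(N + 7N/10).  Since
-- 2^17 ≥ 2 · 3^10, M grows like 2^(N/10), so that the sketch has Ω(N) = Ω(n/ε) bits.

open import Data.Bool as Bool using (Bool; true; false; if_then_else_; _∧_; _∨_; not)
open import Data.Bool.Properties using (∨-comm)
open import Data.Fin as Fin using (Fin; zero; suc; toℕ; fromℕ<)
open import Data.Fin.Properties using (toℕ<n; toℕ-fromℕ<; fromℕ<-toℕ)
open import Data.Fin.Subset as Subset using (Subset; ⁅_⁆)
open import Data.Fin.Subset.Properties using (_∈?_; x∈⁅y⁆⇔x≡y; ∪⇔⊎; x∈∁p⇒x∉p; x∉p⇒x∈∁p)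
open import Data.List as List using (List; []; _∷_; _++_; length; map; filter; allFin; tabulate; cartesianProduct)
open import Data.List.Membership.Propositional using (_∈_)
open import Data.List.Membership.Propositional.Properties using (∈-++⁺ˡ; ∈-++⁺ʳ; ∈-map⁺; ∈-allFin)
open import Data.List.Properties using (map-++; map-∘; map-tabulate; length-++; length-map; length-tabulate)
open import Data.List.Relation.Unary.Any using (here; there)
open import Data.Nat as ℕ using (ℕ; zero; suc; NonZero)
import Data.Nat.DivMod as ℕ
open import Data.Nat.ListAction using (sum)
open import Data.Nat.ListAction.Properties using (sum-++)
import Data.Nat.Properties as ℕ
open import Data.Nat.Tactic.RingSolver using (solve-∀)
open import Data.Product using (Σ-syntax; _×_; _,_; proj₁; proj₂)
open import Data.Sum as Sum using (_⊎_; inj₁; inj₂)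
open import Data.Unit using (⊤; tt)
open import Data.Vec using (Vec; lookup) renaming ([] to []ᵛ; _∷_ to _∷ᵛ_)
open import Function using (_∘_; mk⇔)
open import Level using (Level; Lift; lift)
open import Relation.Binary using (IsDecTotalOrder; Poset)
import Relation.Binary.PropositionalEquality as ≡
open ≡ using (_≡_; _≢_)
import Relation.Binary.Reasoning.PartialOrder as PartialOrderReasoning
open import Relation.Nullary using (Dec; does; yes; no; ¬_; contradiction; _×-dec_; _⊎-dec_; ¬?)
open import Relation.Nullary.Decidable using (does-⇔; dec-true; dec-false; decidable-stable)
open import Relation.Unary using (Pred; Decidable; _∩_; _∪_; ∁)
open import Defs

-- The guarantee is relative: an estimate of a cut of size d may be off by ε·d. One edge is
-- therefore sure to be visible only in cuts of size O(1/ε), and this caps the degree at k. The two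
-- ends of the range of ε act in opposite directions: ε ≤ 1/2 makes k = 1 admissible, while ε ≥ 2/n
-- makes a band of width k fit on n vertices. The fraction 7/10 is 1 - 3/10: each of three queries
-- fails with probability at most 1/10, and no independence is available because they share one
-- sketch and one outcome. The information-theoretic step is an exponential moment bound with base 2
-- in place of an entropy bound, so everything in it is a natural number. Averaging yields a good
-- outcome only up to double negation; this is harmless because the target `suc L ≤ 2 * s` is
-- decidable.

-- Finite sums of natural numbers over lists.

module FiniteSums where
  open import Data.Nat using (_+_; _*_; _≤_; z≤n)
  open import Data.Nat.Properties
  open import Relation.Binary.PropositionalEquality using (refl; sym; trans; cong; cong₂; module ≡-Reasoning)

  ∑ : ∀ {a} {A : Set a} → List A → (A → ℕ) → ℕ
  ∑ xs f = sum (map f xs)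

  module _ {a} {A : Set a} where

    ∑-mono : ∀ (xs : List A) {f g : A → ℕ} → (∀ x → f x ≤ g x) → ∑ xs f ≤ ∑ xs g
    ∑-mono []       f≤g = z≤n
    ∑-mono (x ∷ xs) f≤g = +-mono-≤ (f≤g x) (∑-mono xs f≤g)

    ∑-cong : ∀ (xs : List A) {f g : A → ℕ} → (∀ x → f x ≡ g x) → ∑ xs f ≡ ∑ xs g
    ∑-cong []       f≡g = refl
    ∑-cong (x ∷ xs) f≡g = cong₂ _+_ (f≡g x) (∑-cong xs f≡g)

    ∑-+ : ∀ (xs : List A) (f g : A → ℕ) → ∑ xs (λ x → f x + g x) ≡ ∑ xs f + ∑ xs g
    ∑-+ []       f g = refl
    ∑-+ (x ∷ xs) f g rewrite ∑-+ xs f g = solve4 (f x) (g x) (∑ xs f) (∑ xs g)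
      where
      solve4 : ∀ a b c d → a + b + (c + d) ≡ a + c + (b + d)
      solve4 = solve-∀

    ∑-*ˡ : ∀ (xs : List A) m (f : A → ℕ) → ∑ xs (λ x → m * f x) ≡ m * ∑ xs f
    ∑-*ˡ []       m f = sym (*-zeroʳ m)
    ∑-*ˡ (x ∷ xs) m f rewrite ∑-*ˡ xs m f = sym (*-distribˡ-+ m (f x) (∑ xs f))

    ∑-const : ∀ (xs : List A) m → ∑ xs (λ _ → m) ≡ length xs * m
    ∑-const []       m = refl
    ∑-const (x ∷ xs) m = cong (m +_) (∑-const xs m)

    ∑-++ : ∀ (xs ys : List A) f → ∑ (xs ++ ys) f ≡ ∑ xs f + ∑ ys f
    ∑-++ xs ys f = trans (cong sum (map-++ f xs ys)) (sum-++ (map f xs) (map f ys))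

    ∑-map : ∀ {b} {B : Set b} (h : B → A) (xs : List B) f → ∑ (map h xs) f ≡ ∑ xs (f ∘ h)
    ∑-map h xs f = cong sum (sym (map-∘ {g = f} {f = h} xs))

    term≤∑ : ∀ {xs : List A} {x} (f : A → ℕ) → x ∈ xs → f x ≤ ∑ xs f
    term≤∑ f (here refl) = m≤m+n _ _
    term≤∑ {xs = y ∷ _} f (there x∈xs) = ≤-trans (term≤∑ f x∈xs) (m≤n+m _ (f y))

  ∑-comm : ∀ {a b} {A : Set a} {B : Set b} (xs : List A) (ys : List B) (f : A → B → ℕ) →
           ∑ xs (λ x → ∑ ys (f x)) ≡ ∑ ys (λ y → ∑ xs (λ x → f x y))
  ∑-comm []       ys f = sym (trans (∑-const ys 0) (*-zeroʳ (length ys)))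
  ∑-comm (x ∷ xs) ys f = begin
    ∑ ys (f x) + ∑ xs (λ x → ∑ ys (f x))           ≡⟨ cong (∑ ys (f x) +_) (∑-comm xs ys f) ⟩
    ∑ ys (f x) + ∑ ys (λ y → ∑ xs (λ x → f x y))   ≡⟨ ∑-+ ys (f x) _ ⟨
    ∑ ys (λ y → f x y + ∑ xs (λ x → f x y))        ∎
    where open ≡-Reasoning

  ∑-allFin-suc : ∀ n (f : Fin (suc n) → ℕ) →
                 ∑ (allFin (suc n)) f ≡ f zero + ∑ (allFin n) (f ∘ suc)
  ∑-allFin-suc n f = cong (λ l → f zero + sum l) (begin
    map f (tabulate suc)          ≡⟨ map-tabulate suc f ⟩
    tabulate (f ∘ suc)            ≡⟨ map-tabulate (λ i → i) (f ∘ suc) ⟨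
    map (f ∘ suc) (allFin n)      ∎)
    where open ≡-Reasoning

  𝟙 : Bool → ℕ
  𝟙 b = if b then 1 else 0

  𝟙≤1 : ∀ b → 𝟙 b ≤ 1
  𝟙≤1 true  = ≤-refl
  𝟙≤1 false = z≤n

open FiniteSums

-- Message counting for codes that recover most bits on average.

module RandomAccessCodes where
  open import Data.Nat using (_+_; _*_; _^_; _≤_; _<_; z≤n; s≤s)
  open import Data.Nat.Properties
  open import Relation.Binary.PropositionalEquality using (refl; sym; trans; cong; cong₂; subst₂; module ≡-Reasoning)

  cube : ∀ N → List (Vec Bool N)
  cube zero    = []ᵛ ∷ []
  cube (suc N) = map (true ∷ᵛ_) (cube N) ++ map (false ∷ᵛ_) (cube N)

  ∑-cube-suc : ∀ N (f : Vec Bool (suc N) → ℕ) →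
               ∑ (cube (suc N)) f ≡ ∑ (cube N) (f ∘ (true ∷ᵛ_)) + ∑ (cube N) (f ∘ (false ∷ᵛ_))
  ∑-cube-suc N f = trans (∑-++ (map (true ∷ᵛ_) (cube N)) _ f)
    (cong₂ _+_ (∑-map (true ∷ᵛ_) (cube N) f) (∑-map (false ∷ᵛ_) (cube N) f))

  length-cube : ∀ N → length (cube N) ≡ 2 ^ N
  length-cube zero    = refl
  length-cube (suc N) rewrite length-++ (map (true ∷ᵛ_) (cube N)) {map (false ∷ᵛ_) (cube N)}
    | length-map (true ∷ᵛ_) (cube N) | length-map (false ∷ᵛ_) (cube N) | length-cube N
    | +-identityʳ (2 ^ N) = refl

  agreement : ∀ {N} → Vec Bool N → (Fin N → Bool) → ℕ
  agreement {N} x y = ∑ (allFin N) (λ i → 𝟙 (does (lookup x i Bool.≟ y i)))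

  -- Agreement is additive over coordinates, so the sum factors: whatever `y i` is, coordinate i
  -- contributes 2 for the matching bit and 1 for the other.
  ∑-2^agreement : ∀ N (y : Fin N → Bool) → ∑ (cube N) (λ x → 2 ^ agreement x y) ≡ 3 ^ N
  ∑-2^agreement zero    y = refl
  ∑-2^agreement (suc N) y = begin
    ∑ (cube (suc N)) (λ x → 2 ^ agreement x y)
      ≡⟨ ∑-cube-suc N _ ⟩
    ∑ (cube N) (λ x → 2 ^ agreement (true ∷ᵛ x) y) + ∑ (cube N) (λ x → 2 ^ agreement (false ∷ᵛ x) y)
      ≡⟨ cong₂ _+_ (slice true) (slice false) ⟩
    2 ^ head true * 3 ^ N + 2 ^ head false * 3 ^ N
      ≡⟨ *-distribʳ-+ (3 ^ N) (2 ^ head true) (2 ^ head false) ⟨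
    (2 ^ head true + 2 ^ head false) * 3 ^ N
      ≡⟨ cong (_* 3 ^ N) (heads (y zero)) ⟩
    3 ^ suc N ∎
    where
    open ≡-Reasoning

    head : Bool → ℕ
    head b = 𝟙 (does (b Bool.≟ y zero))

    heads : ∀ c → 2 ^ 𝟙 (does (true Bool.≟ c)) + 2 ^ 𝟙 (does (false Bool.≟ c)) ≡ 3
    heads true  = refl
    heads false = refl

    slice : ∀ b → ∑ (cube N) (λ x → 2 ^ agreement (b ∷ᵛ x) y) ≡ 2 ^ head b * 3 ^ N
    slice b = begin
      ∑ (cube N) (λ x → 2 ^ agreement (b ∷ᵛ x) y)
        ≡⟨ ∑-cong (cube N) (λ x → trans (cong (2 ^_) (∑-allFin-suc N (λ i → 𝟙 (does (lookup (b ∷ᵛ x) i Bool.≟ y i)))))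
                                        (^-distribˡ-+-* 2 (head b) (agreement x (y ∘ suc)))) ⟩
      ∑ (cube N) (λ x → 2 ^ head b * 2 ^ agreement x (y ∘ suc))
        ≡⟨ ∑-*ˡ (cube N) (2 ^ head b) _ ⟩
      2 ^ head b * ∑ (cube N) (λ x → 2 ^ agreement x (y ∘ suc))
        ≡⟨ cong (2 ^ head b *_) (∑-2^agreement N (y ∘ suc)) ⟩
      2 ^ head b * 3 ^ N ∎

  -- A sketch may use fewer than s bits, so the message space includes every shorter string; the
  -- leading `[]` at each level is the string that stops there.
  strings : ℕ → List (List Bool)
  strings zero    = [] ∷ []
  strings (suc s) = [] ∷ map (true ∷_) (strings s) ++ map (false ∷_) (strings s)

  length-strings : ∀ s → suc (length (strings s)) ≡ 2 ^ suc s
  length-strings zero = refl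
  length-strings (suc s)
    rewrite length-++ (map (true ∷_) (strings s)) {map (false ∷_) (strings s)}
          | length-map (true ∷_) (strings s) | length-map (false ∷_) (strings s)
          | sym (length-strings s) = double (length (strings s))
    where
    double : ∀ l → suc (suc (l + l)) ≡ 2 * suc l
    double = solve-∀

  ∈-strings : ∀ {s} m → length m ≤ s → m ∈ strings s
  ∈-strings {zero}  []          _         = here refl
  ∈-strings {suc s} []          _         = here refl
  ∈-strings {suc s} (true  ∷ m) (s≤s m≤s) = there (∈-++⁺ˡ (∈-map⁺ (true ∷_) (∈-strings m m≤s)))
  ∈-strings {suc s} (false ∷ m) (s≤s m≤s) =
    there (∈-++⁺ʳ (map (true ∷_) (strings s)) (∈-map⁺ (false ∷_) (∈-strings m m≤s)))

  -- Convexity of a ↦ 2 ^ a: it lies above the line of slope 2 ^ t through (t , 2 ^ t).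
  tangent : ∀ t a → 2 ^ t * suc a ≤ 2 ^ a + 2 ^ t * t
  tangent zero    zero    = ≤-refl
  tangent zero    (suc a) = begin
    suc (suc a + 0)    ≡⟨ cong suc (+-identityʳ (suc a)) ⟩
    suc (suc a)        ≤⟨ s≤s (subst₂ _≤_ (+-identityʳ _) (+-identityʳ _) (tangent zero a)) ⟩
    1 + 2 ^ a          ≤⟨ +-monoˡ-≤ (2 ^ a) (m^n>0 2 a) ⟩
    2 ^ a + 2 ^ a      ≡⟨ cong (2 ^ a +_) (+-identityʳ (2 ^ a)) ⟨
    2 ^ suc a          ≡⟨ +-identityʳ _ ⟨
    2 ^ suc a + 0      ∎
    where open ≤-Reasoning
  tangent (suc t) zero    = ≤-trans (*-monoʳ-≤ (2 ^ suc t) (s≤s z≤n)) (m≤n+m _ 1)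
  tangent (suc t) (suc a) = begin
    2 * 2 ^ t * suc (suc a)               ≡⟨ lhs (2 ^ t) a ⟩
    2 * (2 ^ t * suc a) + 2 * 2 ^ t       ≤⟨ +-monoˡ-≤ (2 * 2 ^ t) (*-monoʳ-≤ 2 (tangent t a)) ⟩
    2 * (2 ^ a + 2 ^ t * t) + 2 * 2 ^ t   ≡⟨ rhs (2 ^ a) (2 ^ t) t ⟩
    2 * 2 ^ a + 2 * 2 ^ t * suc t         ∎
    where
    open ≤-Reasoning
    lhs : ∀ p a → 2 * p * suc (suc a) ≡ 2 * (p * suc a) + 2 * p
    lhs = solve-∀
    rhs : ∀ q p t → 2 * (q + p * t) + 2 * p ≡ 2 * q + 2 * p * suc t
    rhs = solve-∀

  module _ {N s} (f : Vec Bool N → List Bool) (f-short : ∀ x → length (f x) ≤ s)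
           (y : List Bool → Fin N → Bool) where

    -- The message depends on x, so the value 3 ^ N for a fixed decoded string does not apply
    -- directly. Replacing the term of the actual message by the sum over all messages removes the
    -- dependence, and the two sums can be exchanged.
    ∑-2^agreement-decoded : ∑ (cube N) (λ x → 2 ^ agreement x (y (f x))) ≤ length (strings s) * 3 ^ N
    ∑-2^agreement-decoded = begin
      ∑ (cube N) (λ x → 2 ^ agreement x (y (f x)))
        ≤⟨ ∑-mono (cube N) (λ x → term≤∑ (λ m → 2 ^ agreement x (y m)) (∈-strings (f x) (f-short x))) ⟩
      ∑ (cube N) (λ x → ∑ (strings s) (λ m → 2 ^ agreement x (y m)))
        ≡⟨ ∑-comm (cube N) (strings s) _ ⟩
      ∑ (strings s) (λ m → ∑ (cube N) (λ x → 2 ^ agreement x (y m)))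
        ≡⟨ ∑-cong (strings s) (λ m → ∑-2^agreement N (y m)) ⟩
      ∑ (strings s) (λ _ → 3 ^ N)
        ≡⟨ ∑-const (strings s) (3 ^ N) ⟩
      length (strings s) * 3 ^ N ∎
      where open ≤-Reasoning

    -- Jensen's inequality in division-free form: `tangent` summed over the cube, with the point of
    -- tangency t left free.
    ∑-agreement-decoded : ∀ t →
      2 ^ t * (2 ^ N + ∑ (cube N) (λ x → agreement x (y (f x)))) ≤
      length (strings s) * 3 ^ N + 2 ^ t * t * 2 ^ N
    ∑-agreement-decoded t = begin
      2 ^ t * (2 ^ N + S)
        ≡⟨ cong (λ m → 2 ^ t * (m + S)) (trans (sym (length-cube N)) (trans (sym (*-identityʳ _)) (sym (∑-const (cube N) 1)))) ⟩
      2 ^ t * (∑ (cube N) (λ _ → 1) + S)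
        ≡⟨ cong (2 ^ t *_) (∑-+ (cube N) (λ _ → 1) _) ⟨
      2 ^ t * ∑ (cube N) (λ x → suc (agreement x (y (f x))))
        ≡⟨ ∑-*ˡ (cube N) (2 ^ t) _ ⟨
      ∑ (cube N) (λ x → 2 ^ t * suc (agreement x (y (f x))))
        ≤⟨ ∑-mono (cube N) (λ x → tangent t (agreement x (y (f x)))) ⟩
      ∑ (cube N) (λ x → 2 ^ agreement x (y (f x)) + 2 ^ t * t)
        ≡⟨ ∑-+ (cube N) _ _ ⟩
      ∑ (cube N) (λ x → 2 ^ agreement x (y (f x))) + ∑ (cube N) (λ _ → 2 ^ t * t)
        ≤⟨ +-mono-≤ ∑-2^agreement-decoded (≤-reflexive (trans (∑-const (cube N) _) (trans (cong (_* (2 ^ t * t)) (length-cube N)) (*-comm (2 ^ N) _)))) ⟩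
      length (strings s) * 3 ^ N + 2 ^ t * t * 2 ^ N ∎
      where
      open ≤-Reasoning
      S : ℕ
      S = ∑ (cube N) (λ x → agreement x (y (f x)))

  -- The balance for a block of ten bits: 2 ^ 10 strings times the tangent value 2 ^ 7 at agreement
  -- 7, against the moment 3 ^ 10. The two sides are 118098 and 131072, so each block gains a factor
  -- 2 in the lower bound on the number of messages.
  2^17≥2*3^10 : 2 * 3 ^ 10 ≤ 2 ^ 17
  2^17≥2*3^10 = ≤ᵇ⇒≤ (2 * 3 ^ 10) (2 ^ 17) tt

  ^-distribʳ-* : ∀ n a b → (a * b) ^ n ≡ a ^ n * b ^ n
  ^-distribʳ-* zero    a b = refl
  ^-distribʳ-* (suc n) a b rewrite ^-distribʳ-* n a b = interchange a b (a ^ n) (b ^ n)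
    where
    interchange : ∀ a b c d → a * b * (c * d) ≡ a * c * (b * d)
    interchange = solve-∀

  -- The tangent is taken at `7 * L`, just below 7N/10. The one bit beyond `10 * L` makes the
  -- comparison of 2 ^ L with the number of messages strict, so that even L = 0 requires two
  -- messages and hence s ≥ 1; the factor in `2 * s` then absorbs the step from L ≤ s to `suc L`.
  random-access-bound : ∀ L {s} (let N = suc (10 * L))
    (f : Vec Bool N → List Bool) → (∀ x → length (f x) ≤ s) → (y : List Bool → Fin N → Bool) →
    7 * N * 2 ^ N ≤ 10 * ∑ (cube N) (λ x → agreement x (y (f x))) → suc L ≤ 2 * s
  random-access-bound L {s} f f-short y correct = finish s 2^L<M
    where
    open ≤-Reasoning
    N = suc (10 * L)
    M = length (strings s)
    S = ∑ (cube N) (λ x → agreement x (y (f x)))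
    K = 2 ^ (10 * L)
    Z = 3 ^ (10 * L)
    T = 2 ^ (7 * L)

    expand : ∀ T K L → T * (10 * (2 * K) + 7 * suc (10 * L) * (2 * K)) ≡ 34 * (T * K) + 10 * (T * (7 * L) * (2 * K))
    expand = solve-∀
    collect : ∀ T K S → T * (10 * K + 10 * S) ≡ 10 * (T * (K + S))
    collect = solve-∀
    regroup : ∀ M Z R → 10 * (M * (3 * Z) + R) ≡ 30 * (M * Z) + 10 * R
    regroup = solve-∀

    -- Since 2 ^ N = 2 * K, the 34 is 10 * 2 from the `suc` in `tangent` plus 7 * 2 from the extra
    -- bit; the 30 is 10 * 3 from 3 ^ N = 3 * Z. The terms linear in L agree on both sides and
    -- cancel.
    bound : 34 * (T * K) ≤ 30 * (M * Z)
    bound = +-cancelʳ-≤ (10 * (T * (7 * L) * (2 * K))) _ _ (begin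
      34 * (T * K) + 10 * (T * (7 * L) * (2 * K))         ≡⟨ expand T K L ⟨
      T * (10 * 2 ^ N + 7 * N * 2 ^ N)                    ≤⟨ *-monoʳ-≤ T (+-monoʳ-≤ (10 * 2 ^ N) correct) ⟩
      T * (10 * 2 ^ N + 10 * S)                           ≡⟨ collect T (2 ^ N) S ⟩
      10 * (T * (2 ^ N + S))                              ≤⟨ *-monoʳ-≤ 10 (∑-agreement-decoded f f-short y (7 * L)) ⟩
      10 * (M * 3 ^ N + T * (7 * L) * 2 ^ N)              ≡⟨ regroup M Z _ ⟩
      30 * (M * Z) + 10 * (T * (7 * L) * (2 * K))         ∎)

    2^LZ≤TK : 2 ^ L * Z ≤ T * K
    2^LZ≤TK = begin
      2 ^ L * 3 ^ (10 * L)     ≡⟨ cong (2 ^ L *_) (^-*-assoc 3 10 L) ⟨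
      2 ^ L * (3 ^ 10) ^ L     ≡⟨ ^-distribʳ-* L 2 (3 ^ 10) ⟨
      (2 * 3 ^ 10) ^ L         ≤⟨ ^-monoˡ-≤ L 2^17≥2*3^10 ⟩
      (2 ^ 17) ^ L             ≡⟨ ^-distribʳ-* L (2 ^ 7) (2 ^ 10) ⟩
      (2 ^ 7) ^ L * (2 ^ 10) ^ L ≡⟨ cong₂ _*_ (^-*-assoc 2 7 L) (^-*-assoc 2 10 L) ⟩
      T * K                    ∎

    instance
      Z≢0 : NonZero Z
      Z≢0 = m^n≢0 3 (10 * L)

    34·2^L≤30M : 34 * 2 ^ L ≤ 30 * M
    34·2^L≤30M = *-cancelʳ-≤ (34 * 2 ^ L) (30 * M) Z (begin
      34 * 2 ^ L * Z      ≡⟨ *-assoc 34 (2 ^ L) Z ⟩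
      34 * (2 ^ L * Z)    ≤⟨ *-monoʳ-≤ 34 2^LZ≤TK ⟩
      34 * (T * K)        ≤⟨ bound ⟩
      30 * (M * Z)        ≡⟨ *-assoc 30 M Z ⟨
      30 * M * Z          ∎)

    2^L<M : 2 ^ L < M
    2^L<M = *-cancelˡ-< 30 (2 ^ L) M (<-≤-trans (*-monoˡ-< (2 ^ L) {{m^n≢0 2 L}} (≤ᵇ⇒≤ 31 34 tt)) 34·2^L≤30M)

    finish : ∀ s → 2 ^ L < length (strings s) → suc L ≤ 2 * s
    finish zero    2^L<1 = contradiction (m^n>0 2 L) (<⇒≱ 2^L<1)
    finish (suc s) 2^L<M with L ≤? suc s
    ... | yes L≤s = begin
      suc L         ≤⟨ s≤s L≤s ⟩
      1 + suc s     ≡⟨ +-comm 1 (suc s) ⟩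
      suc s + 1     ≤⟨ +-monoʳ-≤ (suc s) (s≤s z≤n) ⟩
      2 * suc s     ∎
    ... | no  L≰s = contradiction (begin
      suc (length (strings (suc s)))   ≡⟨ length-strings (suc s) ⟩
      2 ^ suc (suc s)                  ≤⟨ ^-monoʳ-≤ 2 (≰⇒> L≰s) ⟩
      2 ^ L                            ∎) (<⇒≱ (<-trans 2^L<M (n<1+n _)))

open RandomAccessCodes

-- Cut sizes of singletons and pairs as double sums over vertices.

module Cuts where
  open import Data.Nat using (_+_; _*_; _≤_; _<_; z≤n; s≤s)
  open import Data.Nat.Properties
  open import Relation.Binary.PropositionalEquality using (refl; sym; trans; cong; cong₂; module ≡-Reasoning)

  length-filter≡∑ : ∀ {a p} {A : Set a} {P : Pred A p} (P? : Decidable P) xs →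
                    length (filter P? xs) ≡ ∑ xs (𝟙 ∘ does ∘ P?)
  length-filter≡∑ P? []       = refl
  length-filter≡∑ P? (x ∷ xs) with does (P? x)
  ... | true  = cong suc (length-filter≡∑ P? xs)
  ... | false = length-filter≡∑ P? xs

  ∑-cartesianProduct : ∀ {a b} {A : Set a} {B : Set b} (xs : List A) (ys : List B) f →
                       ∑ (cartesianProduct xs ys) f ≡ ∑ xs (λ x → ∑ ys (λ y → f (x , y)))
  ∑-cartesianProduct []       ys f = refl
  ∑-cartesianProduct (x ∷ xs) ys f =
    trans (∑-++ (map (x ,_) ys) (cartesianProduct xs ys) f)
          (cong₂ _+_ (∑-map (x ,_) ys f) (∑-cartesianProduct xs ys f))

  ∑-δ : ∀ {n} (u : Fin n) (f : Fin n → ℕ) → ∑ (allFin n) (λ a → 𝟙 (does (a Fin.≟ u)) * f a) ≡ f u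
  ∑-δ {suc n} zero    f = begin
    ∑ (allFin (suc n)) (λ a → 𝟙 (does (a Fin.≟ zero)) * f a)
      ≡⟨ ∑-allFin-suc n (λ a → 𝟙 (does (a Fin.≟ zero)) * f a) ⟩
    1 * f zero + ∑ (allFin n) (λ _ → 0)
      ≡⟨ cong₂ _+_ (*-identityˡ (f zero)) (trans (∑-const (allFin n) 0) (*-zeroʳ (length (allFin n)))) ⟩
    f zero + 0                                                 ≡⟨ +-identityʳ (f zero) ⟩
    f zero                                                     ∎
    where open ≡-Reasoning
  ∑-δ {suc n} (suc u) f = trans (∑-allFin-suc n (λ a → 𝟙 (does (a Fin.≟ suc u)) * f a)) (∑-δ u (f ∘ suc))

  -- Only an inequality: m may be at least n, and then no index matches.
  ∑-toℕ-δ≤ : ∀ n m c → ∑ (allFin n) (λ a → 𝟙 (does (toℕ a ℕ.≟ m)) * c) ≤ c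
  ∑-toℕ-δ≤ zero    m       c = z≤n
  ∑-toℕ-δ≤ (suc n) zero    c = ≤-reflexive (trans (∑-allFin-suc n (λ a → 𝟙 (does (toℕ a ℕ.≟ 0)) * c))
    (trans (cong₂ _+_ (*-identityˡ c) (trans (∑-const (allFin n) 0) (*-zeroʳ (length (allFin n))))) (+-identityʳ c)))
  ∑-toℕ-δ≤ (suc n) (suc m) c = ≤-trans (≤-reflexive (∑-allFin-suc n (λ a → 𝟙 (does (toℕ a ℕ.≟ suc m)) * c))) (∑-toℕ-δ≤ n m c)

  -- Every term but the one at e is bounded by 1; the `suc` is the 1 of k - 1 moved across.
  suc-∑≤ : ∀ k (g : ℕ → ℕ) → (∀ d → g d ≤ 1) → ∀ {e} → e < k →
           suc (∑ (allFin k) (g ∘ toℕ)) ≤ k + g e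
  suc-∑≤ (suc k) g g≤1 {zero} _ = begin
    suc (∑ (allFin (suc k)) (g ∘ toℕ))              ≡⟨ cong suc (∑-allFin-suc k _) ⟩
    suc (g 0 + ∑ (allFin k) (g ∘ suc ∘ toℕ))        ≤⟨ s≤s (+-monoʳ-≤ (g 0) (∑-mono (allFin k) (λ d → g≤1 _))) ⟩
    suc (g 0 + ∑ (allFin k) (λ _ → 1))
      ≡⟨ cong (λ l → suc (g 0 + l)) (trans (∑-const (allFin k) 1) (trans (*-identityʳ _) (length-tabulate (λ i → i)))) ⟩
    suc (g 0 + k)                                   ≡⟨ cong suc (+-comm (g 0) k) ⟩
    suc k + g 0                                     ∎
    where
    open ≤-Reasoning
  suc-∑≤ (suc k) g g≤1 {suc e} (s≤s e<k) = begin
    suc (∑ (allFin (suc k)) (g ∘ toℕ))              ≡⟨ cong suc (∑-allFin-suc k _) ⟩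
    suc (g 0 + ∑ (allFin k) (g ∘ suc ∘ toℕ))        ≡⟨ +-suc (g 0) _ ⟨
    g 0 + suc (∑ (allFin k) (g ∘ suc ∘ toℕ))        ≤⟨ +-mono-≤ (g≤1 0) (suc-∑≤ k (g ∘ suc) (g≤1 ∘ suc) e<k) ⟩
    suc k + g (suc e)                               ∎
    where open ≤-Reasoning

  -- τ enumerates (possibly with repetitions) the support of f, so that f w ≤ ∑_d [w = τ d] f (τ d).
  suc-∑-support≤ : ∀ n k (f τ : ℕ → ℕ) → (∀ w → f w ≤ 1) →
                   (∀ w → f w ≡ 0 ⊎ Σ[ d ∈ ℕ ] d < k × w ≡ τ d) → ∀ {e} → e < k →
                   suc (∑ (allFin n) (f ∘ toℕ)) ≤ k + f (τ e)
  suc-∑-support≤ n k f τ f≤1 support {e} e<k = begin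
    suc (∑ (allFin n) (f ∘ toℕ))
      ≤⟨ s≤s (∑-mono (allFin n) (λ w → f≤ (toℕ w) (support (toℕ w)))) ⟩
    suc (∑ (allFin n) (λ w → ∑ (allFin k) (λ d → 𝟙 (does (toℕ w ℕ.≟ τ (toℕ d))) * f (τ (toℕ d)))))
      ≡⟨ cong suc (∑-comm (allFin n) (allFin k) _) ⟩
    suc (∑ (allFin k) (λ d → ∑ (allFin n) (λ w → 𝟙 (does (toℕ w ℕ.≟ τ (toℕ d))) * f (τ (toℕ d)))))
      ≤⟨ s≤s (∑-mono (allFin k) (λ d → ∑-toℕ-δ≤ n (τ (toℕ d)) (f (τ (toℕ d))))) ⟩
    suc (∑ (allFin k) (f ∘ τ ∘ toℕ))
      ≤⟨ suc-∑≤ k (f ∘ τ) (f≤1 ∘ τ) e<k ⟩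
    k + f (τ e) ∎
    where
    open ≤-Reasoning
    f≤ : ∀ w → f w ≡ 0 ⊎ Σ[ d ∈ ℕ ] d < k × w ≡ τ d →
         f w ≤ ∑ (allFin k) (λ d → 𝟙 (does (w ℕ.≟ τ (toℕ d))) * f (τ (toℕ d)))
    f≤ w (inj₁ fw≡0) = ≤-trans (≤-reflexive fw≡0) z≤n
    f≤ w (inj₂ (d , d<k , w≡τd)) = begin
      f w                                    ≡⟨ cong f w≡ ⟩
      f (τ (toℕ d′))                         ≡⟨ *-identityˡ _ ⟨
      1 * f (τ (toℕ d′))                     ≡⟨ cong (λ b → 𝟙 b * f (τ (toℕ d′))) (dec-true (w ℕ.≟ τ (toℕ d′)) w≡) ⟨
      𝟙 (does (w ℕ.≟ τ (toℕ d′))) * f (τ (toℕ d′))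
        ≤⟨ term≤∑ (λ d → 𝟙 (does (w ℕ.≟ τ (toℕ d))) * f (τ (toℕ d))) (∈-allFin d′) ⟩
      ∑ (allFin k) (λ d → 𝟙 (does (w ℕ.≟ τ (toℕ d))) * f (τ (toℕ d))) ∎
      where
      d′ = fromℕ< d<k
      w≡ : w ≡ τ (toℕ d′)
      w≡ = trans w≡τd (cong τ (sym (toℕ-fromℕ< d<k)))

  does-∈⁅⁆ : ∀ {n} (u a : Fin n) → does (a ∈? ⁅ u ⁆) ≡ does (a Fin.≟ u)
  does-∈⁅⁆ u a = does-⇔ x∈⁅y⁆⇔x≡y (a ∈? ⁅ u ⁆) (a Fin.≟ u)

  does-∈⁅⁆∪⁅⁆ : ∀ {n} (u v a : Fin n) → does (a ∈? ⁅ u ⁆ Subset.∪ ⁅ v ⁆) ≡ does (a Fin.≟ u) ∨ does (a Fin.≟ v)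
  does-∈⁅⁆∪⁅⁆ u v a = trans (does-⇔ ∪⇔⊎ (a ∈? ⁅ u ⁆ Subset.∪ ⁅ v ⁆) (a ∈? ⁅ u ⁆ ⊎-dec a ∈? ⁅ v ⁆))
    (cong₂ _∨_ (does-∈⁅⁆ u a) (does-∈⁅⁆ v a))

  module _ {n : ℕ} (G : Graph n) where
    open Graph G

    private
      crossing : Bool → Bool → Bool → ℕ
      crossing a b e = 𝟙 (a ∧ not b ∧ e)

    -- Passing to a Boolean characteristic function makes the summand a propositional expression, so
    -- that identities between cuts can be checked by cases.
    cutSize≡∑ : ∀ S (χ : Fin n → Bool) → (∀ a → does (a ∈? S) ≡ χ a) →
                cutSize G S ≡ ∑ (allFin n) (λ a → ∑ (allFin n) (λ b → crossing (χ a) (χ b) (adjacent a b)))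
    cutSize≡∑ S χ χ≡ = trans (length-filter≡∑ _ (cartesianProduct (allFin n) (allFin n)))
      (trans (∑-cartesianProduct (allFin n) (allFin n) _)
        (∑-cong (allFin n) λ a → ∑-cong (allFin n) λ b →
          cong₂ (λ s t → 𝟙 (s ∧ t)) (χ≡ a)
            (cong₂ _∧_ (trans (∈∁ b) (cong not (χ≡ b))) (≟true (adjacent a b)))))
      where
      ∈∁ : ∀ b → does (b ∈? Subset.∁ S) ≡ not (does (b ∈? S))
      ∈∁ b = does-⇔ (mk⇔ x∈∁p⇒x∉p x∉p⇒x∈∁p) (b ∈? Subset.∁ S) (¬? (b ∈? S))

      ≟true : ∀ b → does (b Bool.≟ true) ≡ b
      ≟true true  = refl
      ≟true false = refl

    cutSize-⁅⁆≤ : ∀ u → cutSize G ⁅ u ⁆ ≤ ∑ (allFin n) (λ b → 𝟙 (adjacent u b))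
    cutSize-⁅⁆≤ u = begin
      cutSize G ⁅ u ⁆
        ≡⟨ cutSize≡∑ ⁅ u ⁆ (λ a → does (a Fin.≟ u)) (does-∈⁅⁆ u) ⟩
      ∑ (allFin n) (λ a → ∑ (allFin n) (λ b → crossing (does (a Fin.≟ u)) (does (b Fin.≟ u)) (adjacent a b)))
        ≤⟨ ∑-mono (allFin n) (λ a → ∑-mono (allFin n) (λ b → crossing≤ (does (a Fin.≟ u)) (does (b Fin.≟ u)) (adjacent a b))) ⟩
      ∑ (allFin n) (λ a → ∑ (allFin n) (λ b → 𝟙 (does (a Fin.≟ u)) * 𝟙 (adjacent a b)))
        ≡⟨ ∑-cong (allFin n) (λ a → ∑-*ˡ (allFin n) (𝟙 (does (a Fin.≟ u))) _) ⟩
      ∑ (allFin n) (λ a → 𝟙 (does (a Fin.≟ u)) * ∑ (allFin n) (λ b → 𝟙 (adjacent a b)))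
        ≡⟨ ∑-δ u (λ a → ∑ (allFin n) (λ b → 𝟙 (adjacent a b))) ⟩
      ∑ (allFin n) (λ b → 𝟙 (adjacent u b)) ∎
      where
      open ≤-Reasoning
      crossing≤ : ∀ a b e → crossing a b e ≤ 𝟙 a * 𝟙 e
      crossing≤ false b     e = z≤n
      crossing≤ true  true  e = z≤n
      crossing≤ true  false e = ≤-reflexive (sym (*-identityˡ (𝟙 e)))

    -- An edge from the pair to the outside is counted once on each side. The edge uv crosses both
    -- singleton cuts, as (u , v) in one and as (v , u) in the other, but is internal to the pair.
    cutSize-pair : ∀ {u v} → u ≢ v →
                   cutSize G ⁅ u ⁆ + cutSize G ⁅ v ⁆ ≡
                   cutSize G (⁅ u ⁆ Subset.∪ ⁅ v ⁆) + 2 * 𝟙 (adjacent u v)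
    cutSize-pair {u} {v} u≢v = begin
      cutSize G ⁅ u ⁆ + cutSize G ⁅ v ⁆
        ≡⟨ cong₂ _+_ (cutSize≡∑ ⁅ u ⁆ (λ a → does (a Fin.≟ u)) (does-∈⁅⁆ u)) (cutSize≡∑ ⁅ v ⁆ (λ a → does (a Fin.≟ v)) (does-∈⁅⁆ v)) ⟩
      ∑² (λ a b → crossing (a =u) (b =u) (adjacent a b)) + ∑² (λ a b → crossing (a =v) (b =v) (adjacent a b))
        ≡⟨ ∑²-+ _ _ ⟨
      ∑² (λ a b → crossing (a =u) (b =u) (adjacent a b) + crossing (a =v) (b =v) (adjacent a b))
        ≡⟨ ∑-cong (allFin n) (λ a → ∑-cong (allFin n) (λ b → split (a =u) (a =v) (b =u) (b =v) (adjacent a b) (disjoint a) (disjoint b))) ⟩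
      ∑² (λ a b → crossing (a =u ∨ a =v) (b =u ∨ b =v) (adjacent a b) +
                  (edge (a =u) (b =v) (adjacent a b) + edge (a =v) (b =u) (adjacent a b)))
        ≡⟨ trans (∑²-+ _ _) (cong (∑² (λ a b → crossing (a =u ∨ a =v) (b =u ∨ b =v) (adjacent a b)) +_) (∑²-+ _ _)) ⟩
      ∑² (λ a b → crossing (a =u ∨ a =v) (b =u ∨ b =v) (adjacent a b)) +
      (∑² (λ a b → edge (a =u) (b =v) (adjacent a b)) + ∑² (λ a b → edge (a =v) (b =u) (adjacent a b)))
        ≡⟨ cong₂ _+_ (sym (cutSize≡∑ (⁅ u ⁆ Subset.∪ ⁅ v ⁆) (λ a → does (a Fin.≟ u) ∨ does (a Fin.≟ v)) (does-∈⁅⁆∪⁅⁆ u v))) (cong₂ _+_ (∑²-δ u v) (∑²-δ v u)) ⟩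
      cutSize G (⁅ u ⁆ Subset.∪ ⁅ v ⁆) + (𝟙 (adjacent u v) + 𝟙 (adjacent v u))
        ≡⟨ cong (λ b → cutSize G (⁅ u ⁆ Subset.∪ ⁅ v ⁆) + (𝟙 (adjacent u v) + 𝟙 b)) (symmetric v u) ⟩
      cutSize G (⁅ u ⁆ Subset.∪ ⁅ v ⁆) + (𝟙 (adjacent u v) + 𝟙 (adjacent u v))
        ≡⟨ cong (λ m → cutSize G (⁅ u ⁆ Subset.∪ ⁅ v ⁆) + (𝟙 (adjacent u v) + m)) (+-identityʳ _) ⟨
      cutSize G (⁅ u ⁆ Subset.∪ ⁅ v ⁆) + 2 * 𝟙 (adjacent u v) ∎
      where
      open ≡-Reasoning
      _=u _=v : Fin n → Bool
      a =u = does (a Fin.≟ u)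
      a =v = does (a Fin.≟ v)

      ∑² : (Fin n → Fin n → ℕ) → ℕ
      ∑² f = ∑ (allFin n) (λ a → ∑ (allFin n) (f a))

      ∑²-+ : ∀ f g → ∑² (λ a b → f a b + g a b) ≡ ∑² f + ∑² g
      ∑²-+ f g = trans (∑-cong (allFin n) (λ a → ∑-+ (allFin n) (f a) (g a))) (∑-+ (allFin n) _ _)

      edge : Bool → Bool → Bool → ℕ
      edge a b e = 𝟙 a * (𝟙 b * 𝟙 e)

      ∑²-δ : ∀ s t → ∑² (λ a b → edge (does (a Fin.≟ s)) (does (b Fin.≟ t)) (adjacent a b)) ≡ 𝟙 (adjacent s t)
      ∑²-δ s t = begin
        ∑² (λ a b → edge (does (a Fin.≟ s)) (does (b Fin.≟ t)) (adjacent a b))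
          ≡⟨ ∑-cong (allFin n) (λ a → ∑-*ˡ (allFin n) (𝟙 (does (a Fin.≟ s))) (λ b → 𝟙 (does (b Fin.≟ t)) * 𝟙 (adjacent a b))) ⟩
        ∑ (allFin n) (λ a → 𝟙 (does (a Fin.≟ s)) * ∑ (allFin n) (λ b → 𝟙 (does (b Fin.≟ t)) * 𝟙 (adjacent a b)))
          ≡⟨ ∑-δ s (λ a → ∑ (allFin n) (λ b → 𝟙 (does (b Fin.≟ t)) * 𝟙 (adjacent a b))) ⟩
        ∑ (allFin n) (λ b → 𝟙 (does (b Fin.≟ t)) * 𝟙 (adjacent s b))
          ≡⟨ ∑-δ t (λ b → 𝟙 (adjacent s b)) ⟩
        𝟙 (adjacent s t) ∎

      disjoint : ∀ a → (a =u) ∧ (a =v) ≡ false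
      disjoint a = dec-false (a Fin.≟ u ×-dec a Fin.≟ v) (λ (a≡u , a≡v) → u≢v (trans (sym a≡u) a≡v))

      -- The identity for a single ordered pair of vertices. The disjointness hypotheses exclude a
      -- vertex equal to both u and v, which leaves three positions for each end.
      split : ∀ a a′ b b′ e → a ∧ a′ ≡ false → b ∧ b′ ≡ false →
              crossing a b e + crossing a′ b′ e ≡
              crossing (a ∨ a′) (b ∨ b′) e + (edge a b′ e + edge a′ b e)
      split true  false true  false true  _ _ = refl
      split true  false false true  true  _ _ = refl
      split true  false false false true  _ _ = refl
      split false true  true  false true  _ _ = refl
      split false true  false true  true  _ _ = refl
      split false true  false false true  _ _ = refl
      split false false true  false true  _ _ = refl
      split false false false true  true  _ _ = refl
      split false false false false true  _ _ = refl
      split true  false true  false false _ _ = refl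
      split true  false false true  false _ _ = refl
      split true  false false false false _ _ = refl
      split false true  true  false false _ _ = refl
      split false true  false true  false _ _ = refl
      split false true  false false false _ _ = refl
      split false false true  false false _ _ = refl
      split false false false true  false _ _ = refl
      split false false false false false _ _ = refl

open Cuts

-- The hard instances: bipartite band graphs that encode a bit string.

module BandGraphs where
  open import Data.Nat using (_+_; _*_; _∸_; _/_; _%_; _≤_; _<_; s≤s; s≤s⁻¹)
  open import Data.Nat.Properties
  open import Relation.Binary.PropositionalEquality using (refl; sym; trans; cong; cong₂; subst; module ≡-Reasoning)

  open import Data.Nat.DivMod using (m≡m%n+[m/n]*n; m%n<n; m<n*o⇒m/o<n)

  -- Reading `false` past the end means that slots of the band without a bit carry no edge, so N may
  -- be smaller than `p * k`.
  bitAt : ∀ {N} → Vec Bool N → ℕ → Bool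
  bitAt {N} x m with m ℕ.<? N
  ... | yes m<N = lookup x (fromℕ< m<N)
  ... | no  _   = false

  bitAt-toℕ : ∀ {N} (x : Vec Bool N) i → bitAt x (toℕ i) ≡ lookup x i
  bitAt-toℕ {N} x i with toℕ i ℕ.<? N
  ... | yes i<N = cong (lookup x) (fromℕ<-toℕ i i<N)
  ... | no  i≮N = contradiction (toℕ<n i) i≮N

  bitAt-true⇒< : ∀ {N} (x : Vec Bool N) m → bitAt x m ≡ true → m < N
  bitAt-true⇒< {N} x m eq with m ℕ.<? N
  ... | yes m<N = m<N
  ... | no  _   = contradiction eq λ ()

  -- Bit number a * k + d of x decides whether the left vertex a < p is joined to the right vertex
  -- p + a + d, where d < k = suc j.
  module BandGraph {n p j N : ℕ} (0<p : 0 < p) (fits : p + p + suc j ≤ n) (N≤ : N ≤ p * suc j) where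

    k : ℕ
    k = suc j

    module _ (x : Vec Bool N) where

      Edge : ℕ → ℕ → Set
      Edge a b = (p + a ≤ b) × (b < p + a + k) × bitAt x (a * k + (b ∸ (p + a))) ≡ true

      edge? : ∀ a b → Dec (Edge a b)
      edge? a b = (p + a ℕ.≤? b) ×-dec (b ℕ.<? p + a + k) ×-dec (bitAt x (a * k + (b ∸ (p + a))) Bool.≟ true)

      adj : ℕ → ℕ → Bool
      adj a b = does (edge? a b ⊎-dec edge? b a)

      -- `Edge` contains no upper bound on a; it comes from the bit. A set bit has index below N ≤
      -- `p * k`, and the index is at least `a * k`.
      Edge⇒left : ∀ {a b} → Edge a b → a < p
      Edge⇒left {a} {b} (_ , _ , bit) = *-cancelʳ-< k a p (begin-strict
        a * k                        ≤⟨ m≤m+n (a * k) _ ⟩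
        a * k + (b ∸ (p + a))        <⟨ bitAt-true⇒< x _ bit ⟩
        N                            ≤⟨ N≤ ⟩
        p * k                        ∎)
        where open ≤-Reasoning

      Edge⇒right : ∀ {a b} → Edge a b → p ≤ b
      Edge⇒right (p+a≤b , _) = ≤-trans (m≤m+n p _) p+a≤b

      graph : Graph n
      graph = record
        { adjacent    = λ a b → adj (toℕ a) (toℕ b)
        ; symmetric   = λ a b → ∨-comm (does (edge? (toℕ a) (toℕ b))) (does (edge? (toℕ b) (toℕ a)))
        ; irreflexive = λ a → dec-false (edge? (toℕ a) (toℕ a) ⊎-dec edge? (toℕ a) (toℕ a))
            (λ e → let e′ = Sum.reduce e in <⇒≱ (Edge⇒left e′) (Edge⇒right e′))
        }

      adj-band : ∀ {a d} → a < p → d < k → adj a (p + a + d) ≡ bitAt x (a * k + d)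
      adj-band {a} {d} a<p d<k with bitAt x (a * k + d) in bit
      ... | true  = dec-true (edge? a (p + a + d) ⊎-dec edge? (p + a + d) a) (inj₁
        (m≤m+n (p + a) d , +-monoʳ-< (p + a) d<k ,
         trans (cong (λ m → bitAt x (a * k + m)) (m+n∸m≡n (p + a) d)) bit))
      ... | false = dec-false (edge? a (p + a + d) ⊎-dec edge? (p + a + d) a) λ where
        (inj₁ (_ , _ , eq)) → contradiction (trans (sym eq)
          (trans (cong (λ m → bitAt x (a * k + m)) (m+n∸m≡n (p + a) d)) bit)) λ ()
        (inj₂ e) → contradiction (Edge⇒right e) (<⇒≱ a<p)

      adj-comm : ∀ a b → adj a b ≡ adj b a
      adj-comm a b = ∨-comm (does (edge? a b)) (does (edge? b a))

      -- Charging an absent edge (𝟙 bit rather than 1) keeps the case k = 1, ε = 1/2 within the error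
      -- budget of the decoder.
      deg-left≤ : ∀ {a d} → a < p → d < k →
                  ∑ (allFin n) (λ w → 𝟙 (adj a (toℕ w))) ≤ j + 𝟙 (bitAt x (a * k + d))
      deg-left≤ {a} {d} a<p d<k = s≤s⁻¹ (subst (λ b → suc (∑ (allFin n) (λ w → 𝟙 (adj a (toℕ w)))) ≤ k + 𝟙 b) (adj-band a<p d<k)
        (suc-∑-support≤ n k (𝟙 ∘ adj a) (p + a +_) (λ w → 𝟙≤1 (adj a w)) support d<k))
        where
        support : ∀ w → 𝟙 (adj a w) ≡ 0 ⊎ Σ[ d ∈ ℕ ] d < k × w ≡ p + a + d
        support w with edge? a w | edge? w a
        ... | yes (lo , hi , _) | _ = inj₂ (w ∸ (p + a) , m<n+o⇒m∸n<o w (p + a) hi , sym (m+[n∸m]≡n lo))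
        ... | no _ | yes e = contradiction (Edge⇒right e) (<⇒≱ a<p)
        ... | no ¬e | no ¬e′ = inj₁ (cong 𝟙 (dec-false (edge? a w ⊎-dec edge? w a) Sum.[ ¬e , ¬e′ ]))

      deg-right≤ : ∀ {a d} → a < p → d < k →
                   ∑ (allFin n) (λ w → 𝟙 (adj (p + a + d) (toℕ w))) ≤ j + 𝟙 (bitAt x (a * k + d))
      deg-right≤ {a} {d} a<p d<k = s≤s⁻¹ (subst (λ b → suc (∑ (allFin n) (λ w → 𝟙 (adj v (toℕ w)))) ≤ k + 𝟙 b)
        (trans (cong (adj (p + a + d)) τd≡a) (trans (adj-comm (p + a + d) a) (adj-band a<p d<k)))
        (suc-∑-support≤ n k (𝟙 ∘ adj v) τ (λ w → 𝟙≤1 (adj v w)) support d<k))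
        where
        v = p + a + d
        -- The candidate left neighbours of v, indexed by their offset e in the band. Once e exceeds
        -- a + d, truncated subtraction repeats the value 0, which `suc-∑-support≤` permits.
        τ : ℕ → ℕ
        τ e = v ∸ (p + e)
        reassoc : ∀ p a d → p + a + d ≡ (p + d) + a
        reassoc = solve-∀
        τd≡a : τ d ≡ a
        τd≡a = trans (cong (_∸ (p + d)) (reassoc p a d)) (m+n∸m≡n (p + d) a)
        support : ∀ w → 𝟙 (adj v w) ≡ 0 ⊎ Σ[ e ∈ ℕ ] e < k × w ≡ τ e
        support w with edge? v w | edge? w v
        ... | yes e | _ = contradiction (≤-trans (m≤m+n p a) (m≤m+n (p + a) d)) (<⇒≱ (Edge⇒left e))
        ... | no _ | yes (lo , hi , _) = inj₂ (v ∸ (p + w) , m<n+o⇒m∸n<o v (p + w) hi , w≡)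
          where
          open ≡-Reasoning
          e = v ∸ (p + w)
          w≡ : w ≡ v ∸ (p + e)
          w≡ = begin
            w                         ≡⟨ m+n∸m≡n (p + e) w ⟨
            p + e + w ∸ (p + e)       ≡⟨ cong (_∸ (p + e)) (trans (reassoc p e w) (m+[n∸m]≡n lo)) ⟩
            v ∸ (p + e)               ∎
        ... | no ¬e | no ¬e′ = inj₁ (cong 𝟙 (dec-false (edge? v w ⊎-dec edge? w v) Sum.[ ¬e , ¬e′ ]))

    module _ (i : Fin N) where
      private
        a d : ℕ
        a = toℕ i / k
        d = toℕ i % k

        a<p : a < p
        a<p = m<n*o⇒m/o<n (<-≤-trans (toℕ<n i) N≤)

        d<k : d < k
        d<k = m%n<n (toℕ i) k

        v<n : p + a + d < n
        v<n = <-≤-trans (+-mono-<-≤ (+-monoʳ-< p a<p) (<⇒≤ d<k)) fits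

        a<n : a < n
        a<n = ≤-<-trans (≤-trans (m≤n+m a p) (m≤m+n (p + a) d)) v<n

        bit≡ : ∀ x → bitAt x (a * k + d) ≡ lookup x i
        bit≡ x = trans (cong (bitAt x) (trans (+-comm (a * k) d) (sym (m≡m%n+[m/n]*n (toℕ i) k)))) (bitAt-toℕ x i)

      source target : Fin n
      source = fromℕ< a<n
      target = fromℕ< v<n

      source≢target : source ≢ target
      source≢target eq = <⇒≢ (<-≤-trans a<p (≤-trans (m≤m+n p a) (m≤m+n (p + a) d)))
        (trans (sym (toℕ-fromℕ< a<n)) (trans (cong toℕ eq) (toℕ-fromℕ< v<n)))

      module _ (x : Vec Bool N) where

        adjacent≡bit : Graph.adjacent (graph x) source target ≡ lookup x i
        adjacent≡bit = trans (cong₂ (adj x) (toℕ-fromℕ< a<n) (toℕ-fromℕ< v<n)) (trans (adj-band x a<p d<k) (bit≡ x))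

        cutSize-endpoints :
          cutSize (graph x) ⁅ source ⁆ + cutSize (graph x) ⁅ target ⁆ ≡
          cutSize (graph x) (⁅ source ⁆ Subset.∪ ⁅ target ⁆) + 2 * 𝟙 (lookup x i)
        cutSize-endpoints = trans (cutSize-pair (graph x) source≢target)
          (cong (λ b → cutSize (graph x) (⁅ source ⁆ Subset.∪ ⁅ target ⁆) + 2 * 𝟙 b) adjacent≡bit)

        cutSize-source≤ : cutSize (graph x) ⁅ source ⁆ ≤ j + 𝟙 (lookup x i)
        cutSize-source≤ = begin
          cutSize (graph x) ⁅ source ⁆                          ≤⟨ cutSize-⁅⁆≤ (graph x) source ⟩
          ∑ (allFin n) (λ w → 𝟙 (adj x (toℕ source) (toℕ w)))
            ≡⟨ cong (λ u → ∑ (allFin n) (λ w → 𝟙 (adj x u (toℕ w)))) (toℕ-fromℕ< a<n) ⟩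
          ∑ (allFin n) (λ w → 𝟙 (adj x a (toℕ w)))              ≤⟨ deg-left≤ x a<p d<k ⟩
          j + 𝟙 (bitAt x (a * k + d))                           ≡⟨ cong (λ b → j + 𝟙 b) (bit≡ x) ⟩
          j + 𝟙 (lookup x i)                                    ∎
          where open ≤-Reasoning

        cutSize-target≤ : cutSize (graph x) ⁅ target ⁆ ≤ j + 𝟙 (lookup x i)
        cutSize-target≤ = begin
          cutSize (graph x) ⁅ target ⁆                          ≤⟨ cutSize-⁅⁆≤ (graph x) target ⟩
          ∑ (allFin n) (λ w → 𝟙 (adj x (toℕ target) (toℕ w)))
            ≡⟨ cong (λ u → ∑ (allFin n) (λ w → 𝟙 (adj x u (toℕ w)))) (toℕ-fromℕ< v<n) ⟩
          ∑ (allFin n) (λ w → 𝟙 (adj x (p + a + d) (toℕ w)))    ≤⟨ deg-right≤ x a<p d<k ⟩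
          j + 𝟙 (bitAt x (a * k + d))                           ≡⟨ cong (λ b → j + 𝟙 b) (bit≡ x) ⟩
          j + 𝟙 (lookup x i)                                    ∎
          where open ≤-Reasoning

open BandGraphs

-- Ordered-field arithmetic and the error analysis of the threshold test.

module FieldProperties {a ℓ₁ ℓ₂} (ℝ : OrderedField a ℓ₁ ℓ₂) where
  open OrderedField ℝ hiding (zero)
  open IsDecTotalOrder isDecTotalOrder public
    using (_≤?_; total; antisym) renaming (refl to ≤-refl; reflexive to ≤-reflexive; trans to ≤-trans)
  open import Algebra.Properties.Semiring.Mult semiring public using (×-homo-+; ×1-homo-*)
  open import Algebra.Properties.Ring ring public
    using (-‿distribˡ-*; -‿involutive; x+x≈x⇒x≈0)
  open import Algebra.Solver.Ring.NaturalCoefficients.Default commutativeSemiring public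
    using (solve; _:+_; _:*_; _:=_; con)

  poset : Poset a ℓ₁ ℓ₂
  poset = record { isPartialOrder = IsDecTotalOrder.isPartialOrder isDecTotalOrder }

  open PartialOrderReasoning poset

  +-monoʳ-≤ : ∀ z {x y} → x ≤ y → z + x ≤ z + y
  +-monoʳ-≤ z {x} {y} x≤y = begin
    z + x   ≈⟨ +-comm z x ⟩
    x + z   ≤⟨ +-monoˡ-≤ z x≤y ⟩
    y + z   ≈⟨ +-comm y z ⟩
    z + y   ∎

  +-mono-≤ : ∀ {x y u v} → x ≤ y → u ≤ v → x + u ≤ y + v
  +-mono-≤ {y = y} {u} x≤y u≤v = ≤-trans (+-monoˡ-≤ u x≤y) (+-monoʳ-≤ y u≤v)

  x+z-z≈x : ∀ x z → x + z - z ≈ x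
  x+z-z≈x x z = trans (+-assoc x z (- z)) (trans (+-congˡ (-‿inverseʳ z)) (+-identityʳ x))

  +-cancelʳ-≤ : ∀ z {x y} → x + z ≤ y + z → x ≤ y
  +-cancelʳ-≤ z {x} {y} x+z≤y+z = begin
    x           ≈⟨ x+z-z≈x x z ⟨
    x + z - z   ≤⟨ +-monoˡ-≤ (- z) x+z≤y+z ⟩
    y + z - z   ≈⟨ x+z-z≈x y z ⟩
    y           ∎

  +-cancelˡ-≤ : ∀ z {x y} → z + x ≤ z + y → x ≤ y
  +-cancelˡ-≤ z {x} {y} z+x≤z+y = +-cancelʳ-≤ z (begin
    x + z   ≈⟨ +-comm x z ⟩
    z + x   ≤⟨ z+x≤z+y ⟩
    z + y   ≈⟨ +-comm z y ⟩
    y + z   ∎)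

  0≤y-x : ∀ {x y} → x ≤ y → 0# ≤ y - x
  0≤y-x {x} {y} x≤y = begin
    0#      ≈⟨ -‿inverseʳ x ⟨
    x - x   ≤⟨ +-monoˡ-≤ (- x) x≤y ⟩
    y - x   ∎

  *-monoˡ-≤ : ∀ {z} → 0# ≤ z → ∀ {x y} → x ≤ y → x * z ≤ y * z
  *-monoˡ-≤ {z} 0≤z {x} {y} x≤y = begin
    x * z                       ≈⟨ +-identityˡ (x * z) ⟨
    0# + x * z                  ≤⟨ +-monoˡ-≤ (x * z) (*-nonNegative (0≤y-x x≤y) 0≤z) ⟩
    (y - x) * z + x * z         ≈⟨ distribʳ z (y - x) x ⟨
    (y - x + x) * z
      ≈⟨ *-congʳ (trans (+-assoc y (- x) x) (trans (+-congˡ (-‿inverseˡ x)) (+-identityʳ y))) ⟩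
    y * z                       ∎

  *-monoʳ-≤ : ∀ {z} → 0# ≤ z → ∀ {x y} → x ≤ y → z * x ≤ z * y
  *-monoʳ-≤ {z} 0≤z {x} {y} x≤y = begin
    z * x   ≈⟨ *-comm z x ⟩
    x * z   ≤⟨ *-monoˡ-≤ 0≤z x≤y ⟩
    y * z   ≈⟨ *-comm y z ⟩
    z * y   ∎

  0≤1 : 0# ≤ 1#
  0≤1 with total 0# 1#
  ... | inj₁ 0≤1 = 0≤1
  ... | inj₂ 1≤0 = begin
    0#              ≤⟨ *-nonNegative 0≤-1 0≤-1 ⟩
    - 1# * - 1#     ≈⟨ -‿distribˡ-* 1# (- 1#) ⟨
    - (1# * - 1#)   ≈⟨ -‿cong (*-identityˡ (- 1#)) ⟩
    - - 1#          ≈⟨ -‿involutive 1# ⟩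
    1#              ∎
    where
    0≤-1 : 0# ≤ - 1#
    0≤-1 = begin
      0#        ≤⟨ 0≤y-x 1≤0 ⟩
      0# - 1#   ≈⟨ +-identityˡ (- 1#) ⟩
      - 1#      ∎

  1≰0 : ¬ 1# ≤ 0#
  1≰0 1≤0 = 0≉1 (antisym 0≤1 1≤0)

  0≤fromℕ : ∀ m → 0# ≤ fromℕ m
  0≤fromℕ zero    = ≤-refl
  0≤fromℕ (suc m) = begin
    0#              ≈⟨ +-identityˡ 0# ⟨
    0# + 0#         ≤⟨ +-mono-≤ 0≤1 (0≤fromℕ m) ⟩
    1# + fromℕ m    ∎

  fromℕ-mono : ∀ {m n} → m ℕ.≤ n → fromℕ m ≤ fromℕ n
  fromℕ-mono {n = n} ℕ.z≤n = 0≤fromℕ n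
  fromℕ-mono (ℕ.s≤s m≤n)   = +-monoʳ-≤ 1# (fromℕ-mono m≤n)

  -- The way back from the field to integers: `fromℕ` reflects the order because 1 ≰ 0.
  fromℕ-cancel : ∀ m n → fromℕ m ≤ fromℕ n → m ℕ.≤ n
  fromℕ-cancel zero    n       _   = ℕ.z≤n
  fromℕ-cancel (suc m) (suc n) m≤n = ℕ.s≤s (fromℕ-cancel m n (+-cancelˡ-≤ 1# m≤n))
  fromℕ-cancel (suc m) zero    m<0 = contradiction (≤-trans 1≤m+1 m<0) 1≰0
    where
    1≤m+1 : 1# ≤ 1# + fromℕ m
    1≤m+1 = begin
      1#             ≈⟨ +-identityʳ 1# ⟨
      1# + 0#        ≤⟨ +-monoʳ-≤ 1# (0≤fromℕ m) ⟩
      1# + fromℕ m   ∎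

  fromℕ-1 : fromℕ 1 ≈ 1#
  fromℕ-1 = +-identityʳ 1#

  fromℕ-+ : ∀ m n → fromℕ (m ℕ.+ n) ≈ fromℕ m + fromℕ n
  fromℕ-+ = ×-homo-+ 1#

  fromℕ-* : ∀ m n → fromℕ (m ℕ.* n) ≈ fromℕ m * fromℕ n
  fromℕ-* = ×1-homo-*

  fromℕ>0 : ∀ n .{{_ : NonZero n}} → 0# < fromℕ n
  fromℕ>0 (suc n) = 0≤fromℕ (suc n) ,
    λ 0≈ → contradiction (fromℕ-cancel (suc n) 0 (≤-reflexive (sym 0≈))) λ ()

  *-inverse⁺ : ∀ {x} → 0# < x → x * x ⁻¹ ≈ 1#
  *-inverse⁺ (_ , 0≉x) = *-inverseʳ (λ x≈0 → 0≉x (sym x≈0))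

  ⁻¹-nonNegative : ∀ {x} → 0# < x → 0# ≤ x ⁻¹
  ⁻¹-nonNegative {x} 0<x with total 0# (x ⁻¹)
  ... | inj₁ 0≤x⁻¹ = 0≤x⁻¹
  ... | inj₂ x⁻¹≤0 = contradiction (begin
    1#          ≈⟨ *-inverse⁺ 0<x ⟨
    x * x ⁻¹    ≤⟨ *-monoʳ-≤ (proj₁ 0<x) x⁻¹≤0 ⟩
    x * 0#      ≈⟨ zeroʳ x ⟩
    0#          ∎) 1≰0

  x/y*y≈x : ∀ x {y} → 0# < y → x / y * y ≈ x
  x/y*y≈x x {y} 0<y = trans (*-assoc x (y ⁻¹) y)
    (trans (*-congˡ (trans (*-comm (y ⁻¹) y) (*-inverse⁺ 0<y))) (*-identityʳ x))

  x*y/y≈x : ∀ x {y} → 0# < y → x * y / y ≈ x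
  x*y/y≈x x {y} 0<y = trans (*-assoc x y (y ⁻¹)) (trans (*-congˡ (*-inverse⁺ 0<y)) (*-identityʳ x))

  x≤z*y⇒x/y≤z : ∀ {x y z} → 0# < y → x ≤ z * y → x / y ≤ z
  x≤z*y⇒x/y≤z {x} {y} {z} 0<y x≤zy = ≤-trans (*-monoˡ-≤ (⁻¹-nonNegative 0<y) x≤zy) (≤-reflexive (x*y/y≈x z 0<y))

  x/y≤z⇒x≤z*y : ∀ {x y z} → 0# < y → x / y ≤ z → x ≤ z * y
  x/y≤z⇒x≤z*y {x} {y} {z} 0<y x/y≤z = ≤-trans (≤-reflexive (sym (x/y*y≈x x 0<y))) (*-monoˡ-≤ (proj₁ 0<y) x/y≤z)

  x≤z/y⇒x*y≤z : ∀ {x y z} → 0# < y → x ≤ z / y → x * y ≤ z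
  x≤z/y⇒x*y≤z {x} {y} {z} 0<y x≤z/y = ≤-trans (*-monoˡ-≤ (proj₁ 0<y) x≤z/y) (≤-reflexive (x/y*y≈x z 0<y))

  private
    [1-ε]y+εy≈y : ∀ ε y → (1# - ε) * y + ε * y ≈ y
    [1-ε]y+εy≈y ε y = trans (sym (distribʳ y (1# - ε) ε)) (trans (*-congʳ
      (trans (+-assoc 1# (- ε) ε) (trans (+-congˡ (-‿inverseˡ ε)) (+-identityʳ 1#)))) (*-identityˡ y))

  -- With the error term on the other side no subtraction remains, and the later rearrangements are
  -- identities of commutative semirings.
  ∈[1±]⇒lower : ∀ {x ε y} → x ∈[1± ε ] y → y ≤ x + ε * y
  ∈[1±]⇒lower {x} {ε} {y} (lo , _) = begin
    y                       ≈⟨ [1-ε]y+εy≈y ε y ⟨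
    (1# - ε) * y + ε * y    ≤⟨ +-monoˡ-≤ (ε * y) lo ⟩
    x + ε * y               ∎

  ∈[1±]⇒upper : ∀ {x ε y} → x ∈[1± ε ] y → x ≤ y + ε * y
  ∈[1±]⇒upper {x} {ε} {y} (_ , hi) = begin
    x                ≤⟨ hi ⟩
    (1# + ε) * y     ≈⟨ trans (distribʳ y 1# ε) (+-congʳ (*-identityˡ y)) ⟩
    y + ε * y        ∎

  module _ {ε} (0<ε : 0# < ε) {j} (ε-small : ε * fromℕ (4 ℕ.* j ℕ.+ 2) ≤ 1#)
           {d₁ d₂ d₃ e₁ e₂ e₃}
           (good₁ : e₁ ∈[1± ε ] fromℕ d₁) (good₂ : e₂ ∈[1± ε ] fromℕ d₂) (good₃ : e₃ ∈[1± ε ] fromℕ d₃) where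
    private
      D₁ D₂ D₃ : Carrier
      D₁ = fromℕ d₁
      D₂ = fromℕ d₂
      D₃ = fromℕ d₃

    -- The true gap is 2, and the three cuts total at most 2j + (2j + 2) = 4j + 2, so the joint
    -- error is at most 1 and a gap of 1 survives, possibly with equality.
    threshold-reached : d₁ ℕ.+ d₂ ≡ d₃ ℕ.+ 2 → d₃ ℕ.≤ j ℕ.+ j → 1# + e₃ ≤ e₁ + e₂
    threshold-reached d₁+d₂≡ d₃≤2j = +-cancelʳ-≤ (ε * F) (begin
      1# + e₃ + ε * F                        ≤⟨ +-monoˡ-≤ (ε * F) (+-monoʳ-≤ 1# (∈[1±]⇒upper good₃)) ⟩
      1# + (D₃ + ε * D₃) + ε * F
        ≈⟨ solve 3 (λ d e f → con 1 :+ (d :+ e :* d) :+ e :* f := con 1 :+ d :+ e :* (d :+ f)) refl D₃ ε F ⟩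
      1# + D₃ + ε * (D₃ + F)                 ≤⟨ +-monoʳ-≤ (1# + D₃) (≤-trans (*-monoʳ-≤ (proj₁ 0<ε) D₃+F≤) ε-small) ⟩
      1# + D₃ + 1#
        ≈⟨ solve 1 (λ d → con 1 :+ d :+ con 1 := d :+ (con 1 :+ (con 1 :+ con 0))) refl D₃ ⟩
      D₃ + fromℕ 2                           ≈⟨ F≈ ⟨
      F                                      ≤⟨ +-mono-≤ (∈[1±]⇒lower good₁) (∈[1±]⇒lower good₂) ⟩
      (e₁ + ε * D₁) + (e₂ + ε * D₂)
        ≈⟨ solve 5 (λ a b e x y → (a :+ e :* x) :+ (b :+ e :* y) := a :+ b :+ e :* (x :+ y)) refl e₁ e₂ ε D₁ D₂ ⟩
      e₁ + e₂ + ε * F                        ∎)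
      where
      F = D₁ + D₂
      F≈ : F ≈ D₃ + fromℕ 2
      F≈ = trans (sym (fromℕ-+ d₁ d₂)) (trans (reflexive (≡.cong fromℕ d₁+d₂≡)) (fromℕ-+ d₃ 2))
      D₃+F≤ : D₃ + F ≤ fromℕ (4 ℕ.* j ℕ.+ 2)
      D₃+F≤ = begin
        D₃ + F                      ≈⟨ +-congˡ (fromℕ-+ d₁ d₂) ⟨
        D₃ + fromℕ (d₁ ℕ.+ d₂)      ≈⟨ fromℕ-+ d₃ (d₁ ℕ.+ d₂) ⟨
        fromℕ (d₃ ℕ.+ (d₁ ℕ.+ d₂))  ≤⟨ fromℕ-mono bound ⟩
        fromℕ (4 ℕ.* j ℕ.+ 2)       ∎
        where
        twice : ∀ j → j ℕ.+ j ℕ.+ (j ℕ.+ j ℕ.+ 2) ≡ 4 ℕ.* j ℕ.+ 2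
        twice = solve-∀
        bound : d₃ ℕ.+ (d₁ ℕ.+ d₂) ℕ.≤ 4 ℕ.* j ℕ.+ 2
        bound = ℕ.≤-trans (ℕ.+-mono-≤ d₃≤2j (ℕ.≤-trans (ℕ.≤-reflexive d₁+d₂≡) (ℕ.+-monoˡ-≤ 2 d₃≤2j)))
          (ℕ.≤-reflexive (twice j))

    -- The true gap is 0, and the cuts now total at most 4j, two below the budget `4 * j + 2`. As ε
    -- > 0, this slack makes the joint error strictly less than 1.
    threshold-missed : d₁ ℕ.+ d₂ ≡ d₃ → d₃ ℕ.≤ j ℕ.+ j → ¬ 1# + e₃ ≤ e₁ + e₂
    threshold-missed d₁+d₂≡ d₃≤2j reached = proj₂ 0<ε (antisym (proj₁ 0<ε) ε≤0)
      where
      D₃≈ : D₁ + D₂ ≈ D₃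
      D₃≈ = trans (sym (fromℕ-+ d₁ d₂)) (reflexive (≡.cong fromℕ d₁+d₂≡))

      1≤ : 1# ≤ ε * (D₃ + D₃)
      1≤ = +-cancelʳ-≤ D₃ (begin
        1# + D₃                              ≤⟨ +-monoʳ-≤ 1# (∈[1±]⇒lower good₃) ⟩
        1# + (e₃ + ε * D₃)                   ≈⟨ +-assoc 1# e₃ (ε * D₃) ⟨
        1# + e₃ + ε * D₃                     ≤⟨ +-monoˡ-≤ (ε * D₃) reached ⟩
        e₁ + e₂ + ε * D₃
          ≤⟨ +-monoˡ-≤ (ε * D₃) (+-mono-≤ (∈[1±]⇒upper good₁) (∈[1±]⇒upper good₂)) ⟩
        (D₁ + ε * D₁) + (D₂ + ε * D₂) + ε * D₃
          ≈⟨ solve 4 (λ e x y z → (x :+ e :* x) :+ (y :+ e :* y) :+ e :* z := e :* ((x :+ y) :+ z) :+ (x :+ y)) refl ε D₁ D₂ D₃ ⟩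
        ε * ((D₁ + D₂) + D₃) + (D₁ + D₂)     ≈⟨ +-cong (*-congˡ (+-congʳ D₃≈)) D₃≈ ⟩
        ε * (D₃ + D₃) + D₃                   ∎)

      4j : ℕ
      4j = 4 ℕ.* j
      2D₃≤4j : D₃ + D₃ ≤ fromℕ 4j
      2D₃≤4j = begin
        D₃ + D₃             ≈⟨ fromℕ-+ d₃ d₃ ⟨
        fromℕ (d₃ ℕ.+ d₃)   ≤⟨ fromℕ-mono (ℕ.≤-trans (ℕ.+-mono-≤ d₃≤2j d₃≤2j) (ℕ.≤-reflexive (quadruple j))) ⟩
        fromℕ 4j            ∎
        where
        quadruple : ∀ j → j ℕ.+ j ℕ.+ (j ℕ.+ j) ≡ 4 ℕ.* j
        quadruple = solve-∀

      ε≤0 : ε ≤ 0#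
      ε≤0 = +-cancelˡ-≤ (ε * fromℕ 4j) (begin
        ε * fromℕ 4j + ε                ≈⟨ +-congˡ (*-identityʳ ε) ⟨
        ε * fromℕ 4j + ε * 1#           ≈⟨ distribˡ ε (fromℕ 4j) 1# ⟨
        ε * (fromℕ 4j + 1#)             ≤⟨ *-monoʳ-≤ (proj₁ 0<ε) (+-monoʳ-≤ (fromℕ 4j) 1≤2) ⟩
        ε * (fromℕ 4j + fromℕ 2)        ≈⟨ *-congˡ (fromℕ-+ 4j 2) ⟨
        ε * fromℕ (4j ℕ.+ 2)            ≤⟨ ε-small ⟩
        1#                              ≤⟨ 1≤ ⟩
        ε * (D₃ + D₃)                   ≤⟨ *-monoʳ-≤ (proj₁ 0<ε) 2D₃≤4j ⟩
        ε * fromℕ 4j                    ≈⟨ +-identityʳ (ε * fromℕ 4j) ⟨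
        ε * fromℕ 4j + 0#               ∎)
        where
        1≤2 : 1# ≤ fromℕ 2
        1≤2 = ≤-trans (≤-reflexive (sym fromℕ-1)) (fromℕ-mono {1} {2} (ℕ.s≤s ℕ.z≤n))

-- First-moment averaging with finitely additive probability.

module Averaging {a ℓ₁ ℓ₂ o m} {ℝ : OrderedField a ℓ₁ ℓ₂} (P : ProbabilitySpace ℝ o m) where
  open OrderedField ℝ hiding (zero)
  open ProbabilitySpace P
  open FieldProperties ℝ
  open PartialOrderReasoning poset

  -- An empty event is disjoint from itself and equal to its union with itself, so additivity gives
  -- Pr = Pr + Pr.
  Pr-∅ : ∀ {A} (a : Measurable A) → (∀ ω → ¬ A ω) → Pr a ≈ 0#
  Pr-∅ {A} a ∅ = x+x≈x⇒x≈0 (Pr a) (trans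
    (sym (Pr-additive {A} {A} (λ {ω} (x , _) → contradiction x (∅ ω)) a a (measurable-∪ a a)))
    (Pr-cong (Sum.reduce , inj₁) (measurable-∪ a a) a))

  Pr-split : ∀ {A C} → (∀ ω → Dec (A ω)) → (a : Measurable A) (c : Measurable C) →
             Pr c ≈ Pr (measurable-∩ a c) + Pr (measurable-∩ (measurable-∁ a) c)
  Pr-split {A} {C} A? a c = trans (Pr-cong (split , join) c ac∪a̅c)
    (Pr-additive (λ ((x , _) , (¬x , _)) → contradiction x ¬x) ac a̅c ac∪a̅c)
    where
    ac : Measurable (A ∩ C)
    ac = measurable-∩ a c
    a̅c : Measurable (∁ A ∩ C)
    a̅c = measurable-∩ (measurable-∁ a) c
    ac∪a̅c : Measurable ((A ∩ C) ∪ (∁ A ∩ C))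
    ac∪a̅c = measurable-∪ ac a̅c
    split : ∀ {ω} → C ω → ((A ∩ C) ∪ (∁ A ∩ C)) ω
    split {ω} y with A? ω
    ... | yes x = inj₁ (x , y)
    ... | no ¬x = inj₂ (¬x , y)
    join : ∀ {ω} → ((A ∩ C) ∪ (∁ A ∩ C)) ω → C ω
    join = Sum.[ proj₂ , proj₂ ]

  module _ {q} {Q : Set q} {A : Q → Pred Ω ℓ₂} (A? : ∀ q ω → Dec (A q ω)) (meas : ∀ q → Measurable (A q)) where

    count : Ω → List Q → ℕ
    count ω qs = ∑ qs (λ q → 𝟙 (does (A? q ω)))

    -- The expectation of `count` restricted to the event C, written out by linearity. Carrying C
    -- along lets an induction split on one event of the list at a time.
    ∑Pr : List Q → ∀ {C} → Measurable C → Carrier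
    ∑Pr []       c = 0#
    ∑Pr (q ∷ qs) c = Pr (measurable-∩ (meas q) c) + ∑Pr qs c

    ∑Pr-split : ∀ qs {D C} → (∀ ω → Dec (D ω)) → (d : Measurable D) (c : Measurable C) →
                ∑Pr qs c ≈ ∑Pr qs (measurable-∩ d c) + ∑Pr qs (measurable-∩ (measurable-∁ d) c)
    ∑Pr-split []       D? d c = sym (+-identityˡ 0#)
    ∑Pr-split (q ∷ qs) D? d c = trans
      (+-cong (trans (Pr-split D? d qc) (+-cong (Pr-cong ((λ (x , y , z) → y , x , z) , λ (y , x , z) → x , y , z) _ _)
                                                 (Pr-cong ((λ (x , y , z) → y , x , z) , λ (y , x , z) → x , y , z) _ _)))
              (∑Pr-split qs D? d c))
      (solve 4 (λ a b c d → (a :+ b) :+ (c :+ d) := (a :+ c) :+ (b :+ d)) refl _ _ _ _)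
      where
      qc = measurable-∩ (meas q) c

    -- C is split according to the first event. Where that event occurs, the remaining count is at
    -- most b - 1, and the missing unit pays for the event itself; if b = 0 this part is empty and
    -- has probability 0. Elsewhere the bound b passes to the tail unchanged.
    ∑Pr≤ : ∀ qs {C} (c : Measurable C) b → (∀ ω → C ω → count ω qs ℕ.≤ b) → ∑Pr qs c ≤ fromℕ b * Pr c
    ∑Pr≤ []       c b _      = *-nonNegative (0≤fromℕ b) (Pr-nonNegative c)
    ∑Pr≤ (q ∷ qs) {C} c b count≤ = begin
      Pr qc + ∑Pr qs c                       ≈⟨ +-congˡ (∑Pr-split qs (A? q) (meas q) c) ⟩
      Pr qc + (∑Pr qs qc + ∑Pr qs q̅c)        ≈⟨ +-assoc (Pr qc) (∑Pr qs qc) (∑Pr qs q̅c) ⟨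
      Pr qc + ∑Pr qs qc + ∑Pr qs q̅c
        ≤⟨ +-mono-≤ (occurs b λ ω x → ≡.subst (ℕ._≤ b) (count-yes (proj₁ x)) (count≤ ω (proj₂ x)))
                                                         (∑Pr≤ qs q̅c b λ ω x → ≡.subst (ℕ._≤ b) (count-no (proj₁ x)) (count≤ ω (proj₂ x))) ⟩
      fromℕ b * Pr qc + fromℕ b * Pr q̅c      ≈⟨ distribˡ (fromℕ b) (Pr qc) (Pr q̅c) ⟨
      fromℕ b * (Pr qc + Pr q̅c)              ≈⟨ *-congˡ (Pr-split (A? q) (meas q) c) ⟨
      fromℕ b * Pr c                         ∎
      where
      qc = measurable-∩ (meas q) c
      q̅c = measurable-∩ (measurable-∁ (meas q)) c

      count-yes : ∀ {ω} → A q ω → count ω (q ∷ qs) ≡ suc (count ω qs)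
      count-yes {ω} x with A? q ω
      ... | yes _ = ≡.refl
      ... | no ¬x = contradiction x ¬x

      count-no : ∀ {ω} → ¬ A q ω → count ω (q ∷ qs) ≡ count ω qs
      count-no {ω} ¬x with A? q ω
      ... | yes x = contradiction x ¬x
      ... | no _  = ≡.refl

      occurs : ∀ b → (∀ ω → (A q ∩ C) ω → suc (count ω qs) ℕ.≤ b) → Pr qc + ∑Pr qs qc ≤ fromℕ b * Pr qc
      occurs zero    count< = begin
        Pr qc + ∑Pr qs qc      ≤⟨ +-mono-≤ (≤-reflexive (Pr-∅ qc λ ω x → contradiction (count< ω x) λ ()))
                                           (∑Pr≤ qs qc 0 λ ω x → contradiction (count< ω x) λ ()) ⟩
        0# + 0# * Pr qc        ≈⟨ +-identityˡ (0# * Pr qc) ⟩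
        0# * Pr qc             ∎
      occurs (suc b) count< = begin
        Pr qc + ∑Pr qs qc                ≤⟨ +-monoʳ-≤ (Pr qc) (∑Pr≤ qs qc b λ ω x → ℕ.s≤s⁻¹ (count< ω x)) ⟩
        Pr qc + fromℕ b * Pr qc          ≈⟨ +-congʳ (*-identityˡ (Pr qc)) ⟨
        1# * Pr qc + fromℕ b * Pr qc     ≈⟨ distribʳ (Pr qc) 1# (fromℕ b) ⟨
        fromℕ (suc b) * Pr qc            ∎

    ∑Pr≥ : ∀ qs {C} (c : Measurable C) → (∀ ω → C ω) → ∀ {r} → (∀ q → r ≤ Pr (meas q)) → fromℕ (length qs) * r ≤ ∑Pr qs c
    ∑Pr≥ []       c full {r} r≤ = ≤-reflexive (zeroˡ r)
    ∑Pr≥ (q ∷ qs) c full {r} r≤ = begin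
      (1# + fromℕ (length qs)) * r                      ≈⟨ distribʳ r 1# (fromℕ (length qs)) ⟩
      1# * r + fromℕ (length qs) * r                    ≈⟨ +-congʳ (*-identityˡ r) ⟩
      r + fromℕ (length qs) * r
        ≤⟨ +-mono-≤ (≤-trans (r≤ q) (≤-reflexive (Pr-cong ((λ x → x , full _) , proj₁) (meas q) (measurable-∩ (meas q) c)))) (∑Pr≥ qs c full r≤) ⟩
      Pr (measurable-∩ (meas q) c) + ∑Pr qs c           ∎

    average≤max : ∀ qs {k l} .{{_ : NonZero l}} → (∀ q → fromℕ k / fromℕ l ≤ Pr (meas q)) →
                  ∀ b → (∀ ω → count ω qs ℕ.≤ b) → length qs ℕ.* k ℕ.≤ b ℕ.* l
    average≤max qs {k} {l} k/l≤ b count≤ = fromℕ-cancel _ _ (begin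
      fromℕ (length qs ℕ.* k)                       ≈⟨ fromℕ-* (length qs) k ⟩
      fromℕ (length qs) * fromℕ k                   ≈⟨ *-congˡ (x/y*y≈x (fromℕ k) (fromℕ>0 l)) ⟨
      fromℕ (length qs) * (fromℕ k / fromℕ l * fromℕ l)   ≈⟨ *-assoc _ _ _ ⟨
      fromℕ (length qs) * (fromℕ k / fromℕ l) * fromℕ l
        ≤⟨ *-monoˡ-≤ (0≤fromℕ l) (≤-trans (∑Pr≥ qs u (λ _ → lift tt) k/l≤) (∑Pr≤ qs u b λ ω _ → count≤ ω)) ⟩
      fromℕ b * Pr u * fromℕ l
        ≈⟨ *-congʳ (trans (*-congˡ (Pr-U (λ _ → lift tt) u)) (*-identityʳ (fromℕ b))) ⟩
      fromℕ b * fromℕ l                             ≈⟨ fromℕ-* b l ⟨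
      fromℕ (b ℕ.* l)                               ∎)
      where
      u : Measurable (λ _ → Lift ℓ₂ ⊤)
      u = measurable-U (λ _ → lift tt)

    -- An outcome that does at least as well as the average exists, but without a choice of outcome
    -- only its double negation is available.
    ¬-always-below-average : ∀ qs {k l} .{{_ : NonZero l}} → (∀ q → fromℕ k / fromℕ l ≤ Pr (meas q)) →
                             0 ℕ.< length qs ℕ.* k → ¬ (∀ ω → count ω qs ℕ.* l ℕ.< length qs ℕ.* k)
    ¬-always-below-average qs {k} {l} k/l≤ 0<lk count< = ℕ.<⇒≱ (pred-< 0<lk) (ℕ.≤-trans
      -- The greatest integer b with `b * l` below `length qs * k`: the strict bounds, one for each
      -- ω, become a single integer bound uniform in ω.
      (average≤max qs k/l≤ (ℕ.pred (length qs ℕ.* k) ℕ./ l)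
        (λ ω → ≡.subst (ℕ._≤ _) (ℕ.m*n/n≡m (count ω qs) l) (ℕ./-monoˡ-≤ l (ℕ.<⇒≤pred (count< ω)))))
      (ℕ.m/n*n≤m _ l))
      where
      pred-< : ∀ {m} → 0 ℕ.< m → ℕ.pred m ℕ.< m
      pred-< {suc m} _ = ℕ.n<1+n m

-- Plays the role of rounding a quotient of field elements down to an integer. In a field that may
-- be non-Archimedean, the search needs an explicit m at which P fails.
last-true : ∀ {ℓ} {P : Pred ℕ ℓ} → Decidable P → P 0 → ∀ m → ¬ P m → Σ[ j ∈ ℕ ] P j × ¬ P (suc j)
last-true P? P0 zero    ¬P0 = contradiction P0 ¬P0
last-true P? P0 (suc m) ¬Psm with P? m
... | yes Pm = m , Pm , ¬Psm
... | no ¬Pm = last-true P? P0 m ¬Pm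

length≡∑1 : ∀ {a} {A : Set a} (xs : List A) → length xs ≡ ∑ xs (λ _ → 1)
length≡∑1 xs = ≡.sym (≡.trans (∑-const xs 1) (ℕ.*-identityʳ (length xs)))

-- The union bound in counting form: unless all three succeed, at most two do. On average 27/10 of
-- the three queries succeed, so at least 7/10 is left for Q.
∑₃≤2+ : ∀ {p q} {P : Fin 3 → Set p} {Q : Set q} (P? : ∀ t → Dec (P t)) (Q? : Dec Q) →
        ((∀ t → P t) → Q) → ∑ (allFin 3) (λ t → 𝟙 (does (P? t))) ℕ.≤ 2 ℕ.+ 𝟙 (does Q?)
∑₃≤2+ P? Q? P⇒Q with P? zero | P? (suc zero) | P? (suc (suc zero))
... | yes p₀ | yes p₁ | yes p₂ = ℕ.≤-reflexive (≡.cong (λ b → 2 ℕ.+ 𝟙 b) (≡.sym (dec-true Q?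
  (P⇒Q λ { zero → p₀ ; (suc zero) → p₁ ; (suc (suc zero)) → p₂ }))))
... | no _   | b      | c      = ℕ.≤-trans (ℕ.+-mono-≤ (𝟙≤1 (does b)) (ℕ.+-mono-≤ (𝟙≤1 (does c)) (ℕ.z≤n {0}))) (ℕ.m≤m+n 2 _)
... | yes _  | no _   | c      = ℕ.≤-trans (ℕ.s≤s (ℕ.+-mono-≤ (𝟙≤1 (does c)) (ℕ.z≤n {0}))) (ℕ.m≤m+n 2 _)
... | yes _  | yes _  | no _   = ℕ.m≤m+n 2 _

-- Turning a cut sketch into a random access code.

module Decoding {a ℓ₁ ℓ₂ o m} {ℝ : OrderedField a ℓ₁ ℓ₂} (P : ProbabilitySpace ℝ o m) where
  open OrderedField ℝ using (Carrier; 0#; 1#; _+_; _*_; _≤_; _<_; _/_; fromℕ; _∈[1±_]_)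
  open ProbabilitySpace P
  open FieldProperties ℝ using (_≤?_; threshold-reached; threshold-missed)
  open Averaging P

  module _
    {n p j L s : ℕ} (0<p : 0 ℕ.< p) (fits : p ℕ.+ p ℕ.+ suc j ℕ.≤ n) (N≤ : suc (10 ℕ.* L) ℕ.≤ p ℕ.* suc j)
    {ε : Carrier} (0<ε : 0# < ε) (ε-small : ε * fromℕ (4 ℕ.* j ℕ.+ 2) ≤ 1#)
    (sk : Ω → Graph n → List Bool) (est : Ω → Subset n → List Bool → Carrier)
    (sk-short : ∀ ω G → length (sk ω G) ℕ.≤ s)
    (accurate : ∀ (G : Graph n) (S : Subset n) →
       Pr[ (λ ω → est ω S (sk ω G) ∈[1± ε ] fromℕ (cutSize G S)) ]≥ (fromℕ 9 / fromℕ 10)) where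

    open BandGraph {n} {p} {j} 0<p fits N≤

    N : ℕ
    N = suc (10 ℕ.* L)

    querySet : Fin N → Fin 3 → Subset n
    querySet i zero             = ⁅ source i ⁆
    querySet i (suc zero)       = ⁅ target i ⁆
    querySet i (suc (suc zero)) = ⁅ source i ⁆ Subset.∪ ⁅ target i ⁆

    Query : Set
    Query = Vec Bool N × Fin N × Fin 3

    Good : Query → Pred Ω ℓ₂
    Good (x , i , t) ω = est ω (querySet i t) (sk ω (graph x)) ∈[1± ε ] fromℕ (cutSize (graph x) (querySet i t))

    good? : ∀ q ω → Dec (Good q ω)
    good? _ _ = (_ ≤? _) ×-dec (_ ≤? _)

    good-measurable : ∀ q → Measurable (Good q)
    good-measurable (x , i , t) = proj₁ (accurate (graph x) (querySet i t))

    reached? : ∀ ω (msg : List Bool) i →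
      Dec (1# + est ω (querySet i (suc (suc zero))) msg ≤ est ω (querySet i zero) msg + est ω (querySet i (suc zero)) msg)
    reached? ω msg i = _ ≤? _

    -- The graph enters only through `msg`, so for fixed ω this is a decoder of the message alone,
    -- as the counting bound requires.
    decode : Ω → List Bool → Fin N → Bool
    decode ω msg i = does (reached? ω msg i)

    module _ (ω : Ω) (x : Vec Bool N) (i : Fin N) where
      private
        cut : Fin 3 → ℕ
        cut t = cutSize (graph x) (querySet i t)

        module _ (good : ∀ t → Good (x , i , t) ω) where

          d≤ : ∀ {b} → lookup x i ≡ b → cut zero ℕ.+ cut (suc zero) ℕ.≤ (j ℕ.+ 𝟙 b) ℕ.+ (j ℕ.+ 𝟙 b)
          d≤ ≡.refl = ℕ.+-mono-≤ (cutSize-source≤ i x) (cutSize-target≤ i x)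

          d≡ : ∀ {b} → lookup x i ≡ b → cut zero ℕ.+ cut (suc zero) ≡ cut (suc (suc zero)) ℕ.+ 2 ℕ.* 𝟙 b
          d≡ ≡.refl = cutSize-endpoints i x

      decode-correct : (∀ t → Good (x , i , t) ω) → lookup x i ≡ decode ω (sk ω (graph x)) i
      decode-correct good with lookup x i in bit
      ... | true  = ≡.sym (dec-true (reached? ω (sk ω (graph x)) i)
          (threshold-reached 0<ε {j} ε-small {cut zero} {cut (suc zero)} {cut (suc (suc zero))} (good zero) (good (suc zero)) (good (suc (suc zero)))
            (d≡ good bit)
            -- The cut of the pair is bounded through the singletons: d₃ + 2 = d₁ + d₂ ≤ (j + 1) +
            -- (j + 1).
            (ℕ.+-cancelʳ-≤ 2 _ _ (≡.subst₂ ℕ._≤_ (d≡ good bit) (shift j) (d≤ good bit)))))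
        where
        shift : ∀ j → (j ℕ.+ 1) ℕ.+ (j ℕ.+ 1) ≡ j ℕ.+ j ℕ.+ 2
        shift = solve-∀
      ... | false = ≡.sym (dec-false (reached? ω (sk ω (graph x)) i)
          (threshold-missed 0<ε {j} ε-small {cut zero} {cut (suc zero)} {cut (suc (suc zero))} (good zero) (good (suc zero)) (good (suc (suc zero)))
            d≡′
            (≡.subst₂ ℕ._≤_ d≡′ (≡.cong₂ ℕ._+_ (ℕ.+-identityʳ j) (ℕ.+-identityʳ j)) (d≤ good bit))))
        where
        d≡′ = ≡.trans (d≡ good bit) (ℕ.+-identityʳ _)

      good-count≤ : ∑ (allFin 3) (λ t → 𝟙 (does (good? (x , i , t) ω))) ℕ.≤
                    2 ℕ.+ 𝟙 (does (lookup x i Bool.≟ decode ω (sk ω (graph x)) i))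
      good-count≤ = ∑₃≤2+ (λ t → good? (x , i , t) ω) (lookup x i Bool.≟ decode ω (sk ω (graph x)) i) decode-correct

    queries : List Query
    queries = cartesianProduct (cube N) (cartesianProduct (allFin N) (allFin 3))

    ∑-queries : ∀ f → ∑ queries f ≡ ∑ (cube N) (λ x → ∑ (allFin N) (λ i → ∑ (allFin 3) (λ t → f (x , i , t))))
    ∑-queries f = ≡.trans (∑-cartesianProduct (cube N) _ f)
      (∑-cong (cube N) (λ x → ∑-cartesianProduct (allFin N) (allFin 3) (λ q → f (x , q))))

    length-queries : length queries ≡ 2 ℕ.^ N ℕ.* (N ℕ.* 3)
    length-queries = begin
      length queries                                                          ≡⟨ length≡∑1 queries ⟩
      ∑ queries (λ _ → 1)                                                     ≡⟨ ∑-queries (λ _ → 1) ⟩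
      ∑ (cube N) (λ _ → ∑ (allFin N) (λ _ → 3))                               ≡⟨ ∑-const (cube N) _ ⟩
      length (cube N) ℕ.* ∑ (allFin N) (λ _ → 3)
        ≡⟨ ≡.cong₂ ℕ._*_ (length-cube N) (∑-const (allFin N) 3) ⟩
      2 ℕ.^ N ℕ.* (length (allFin N) ℕ.* 3)
        ≡⟨ ≡.cong (λ l → 2 ℕ.^ N ℕ.* (l ℕ.* 3)) (length-tabulate {n = N} (λ i → i)) ⟩
      2 ℕ.^ N ℕ.* (N ℕ.* 3)                                                   ∎
      where open ≡.≡-Reasoning

    agreements : Ω → ℕ
    agreements ω = ∑ (cube N) (λ x → agreement x (decode ω (sk ω (graph x))))

    count≤ : ∀ ω → count good? good-measurable ω queries ℕ.≤ 2 ℕ.^ N ℕ.* (N ℕ.* 2) ℕ.+ agreements ω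
    count≤ ω = begin
      ∑ queries (λ q → 𝟙 (does (good? q ω)))
        ≡⟨ ∑-queries (λ q → 𝟙 (does (good? q ω))) ⟩
      ∑ (cube N) (λ x → ∑ (allFin N) (λ i → ∑ (allFin 3) (λ t → 𝟙 (does (good? (x , i , t) ω)))))
        ≤⟨ ∑-mono (cube N) (λ x → ∑-mono (allFin N) (good-count≤ ω x)) ⟩
      ∑ (cube N) (λ x → ∑ (allFin N) (λ i → 2 ℕ.+ 𝟙 (does (lookup x i Bool.≟ decode ω (sk ω (graph x)) i))))
        ≡⟨ ∑-cong (cube N) (λ x → ∑-+ (allFin N) (λ _ → 2) (λ i → 𝟙 (does (lookup x i Bool.≟ decode ω (sk ω (graph x)) i)))) ⟩
      ∑ (cube N) (λ x → ∑ (allFin N) (λ _ → 2) ℕ.+ agreement x (decode ω (sk ω (graph x))))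
        ≡⟨ ∑-+ (cube N) (λ _ → ∑ (allFin N) (λ _ → 2)) (λ x → agreement x (decode ω (sk ω (graph x)))) ⟩
      ∑ (cube N) (λ _ → ∑ (allFin N) (λ _ → 2)) ℕ.+ agreements ω
        ≡⟨ ≡.cong (ℕ._+ agreements ω) (≡.trans (∑-const (cube N) _) (≡.cong₂ ℕ._*_ (length-cube N)
             (≡.trans (∑-const (allFin N) 2) (≡.cong (ℕ._* 2) (length-tabulate {n = N} (λ i → i)))))) ⟩
      2 ℕ.^ N ℕ.* (N ℕ.* 2) ℕ.+ agreements ω ∎
      where open ℕ.≤-Reasoning

    -- If the bound failed, `random-access-bound` would leave every ω with fewer than 7/10 of the
    -- bits. In tenths of a query per pair of string and bit, that is less than 20 + 7 = 27 = 3 * 9,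
    -- below the guaranteed average for every ω, which is impossible.
    sketch-bound : suc L ℕ.≤ 2 ℕ.* s
    sketch-bound = decidable-stable (suc L ℕ.≤? 2 ℕ.* s) λ L≮2s →
      ¬-always-below-average good? good-measurable queries {9} {10}
        (λ (x , i , t) → proj₂ (accurate (graph x) (querySet i t))) 0<9·len λ ω → below L≮2s ω
      where
      open ℕ.≤-Reasoning
      K = 2 ℕ.^ N

      0<9·len : 0 ℕ.< length queries ℕ.* 9
      0<9·len = ≡.subst (λ l → 0 ℕ.< l ℕ.* 9) (≡.sym length-queries)
        (ℕ.*-mono-< {0} {K ℕ.* (N ℕ.* 3)} {0} {9} (ℕ.*-mono-< {0} {K} {0} {N ℕ.* 3} (ℕ.m^n>0 2 N) (ℕ.s≤s ℕ.z≤n)) (ℕ.s≤s ℕ.z≤n))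

      lhs : ∀ K N S → (K ℕ.* (N ℕ.* 2) ℕ.+ S) ℕ.* 10 ≡ 20 ℕ.* (N ℕ.* K) ℕ.+ 10 ℕ.* S
      lhs = solve-∀
      rhs : ∀ K N → 20 ℕ.* (N ℕ.* K) ℕ.+ 7 ℕ.* N ℕ.* K ≡ K ℕ.* (N ℕ.* 3) ℕ.* 9
      rhs = solve-∀

      below : ¬ (suc L ℕ.≤ 2 ℕ.* s) → ∀ ω → count good? good-measurable ω queries ℕ.* 10 ℕ.< length queries ℕ.* 9
      below L≮2s ω = begin-strict
        count good? good-measurable ω queries ℕ.* 10       ≤⟨ ℕ.*-monoˡ-≤ 10 (count≤ ω) ⟩
        (K ℕ.* (N ℕ.* 2) ℕ.+ agreements ω) ℕ.* 10          ≡⟨ lhs K N (agreements ω) ⟩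
        20 ℕ.* (N ℕ.* K) ℕ.+ 10 ℕ.* agreements ω           <⟨ ℕ.+-monoʳ-< (20 ℕ.* (N ℕ.* K)) (ℕ.≰⇒> λ correct →
                                                                L≮2s (random-access-bound L (λ x → sk ω (graph x)) (λ x → sk-short ω (graph x)) (decode ω) correct)) ⟩
        20 ℕ.* (N ℕ.* K) ℕ.+ 7 ℕ.* N ℕ.* K                 ≡⟨ rhs K N ⟩
        K ℕ.* (N ℕ.* 3) ℕ.* 9                              ≡⟨ ≡.cong (ℕ._* 9) length-queries ⟨
        length queries ℕ.* 9                               ∎

-- Integer inequalities for the choice of parameters.

≤8*[/4] : ∀ {n} → 4 ℕ.≤ n → n ℕ.≤ 8 ℕ.* (n ℕ./ 4)
≤8*[/4] {n} 4≤n = begin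
  n                                  ≡⟨ ℕ.m≡m%n+[m/n]*n n 4 ⟩
  n ℕ.% 4 ℕ.+ n ℕ./ 4 ℕ.* 4          ≤⟨ ℕ.+-monoˡ-≤ (n ℕ./ 4 ℕ.* 4) (ℕ.<⇒≤ (ℕ.m%n<n n 4)) ⟩
  4 ℕ.+ n ℕ./ 4 ℕ.* 4                ≤⟨ ℕ.+-monoˡ-≤ (n ℕ./ 4 ℕ.* 4) (ℕ.*-monoˡ-≤ 4 (ℕ.m≥n⇒m/n>0 4≤n)) ⟩
  n ℕ./ 4 ℕ.* 4 ℕ.+ n ℕ./ 4 ℕ.* 4    ≡⟨ double (n ℕ./ 4) ⟩
  8 ℕ.* (n ℕ./ 4)                    ∎
  where
  open ℕ.≤-Reasoning
  double : ∀ q → q ℕ.* 4 ℕ.+ q ℕ.* 4 ≡ 8 ℕ.* q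
  double = solve-∀

-- The two stretches of length p take at most n/2, and the overhang j + 1 ≤ n/8 + 1/2 is at most n/4
-- once n ≥ 4.
two-quarters+≤ : ∀ n p j → p ℕ.* 4 ℕ.≤ n → 4 ℕ.≤ n → 2 ℕ.* (4 ℕ.* j ℕ.+ 2) ℕ.≤ n → p ℕ.+ p ℕ.+ suc j ℕ.≤ n
two-quarters+≤ n p j 4p≤n 4≤n 8j+4≤n = ℕ.*-cancelʳ-≤ (p ℕ.+ p ℕ.+ suc j) n 8 (begin
  (p ℕ.+ p ℕ.+ suc j) ℕ.* 8                                ≡⟨ expand p j ⟩
  4 ℕ.* (p ℕ.* 4) ℕ.+ (2 ℕ.* (4 ℕ.* j ℕ.+ 2) ℕ.+ 4)
    ≤⟨ ℕ.+-mono-≤ (ℕ.*-monoʳ-≤ 4 4p≤n) (ℕ.+-mono-≤ 8j+4≤n 4≤n) ⟩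
  4 ℕ.* n ℕ.+ (n ℕ.+ n)                                    ≤⟨ ℕ.m≤m+n _ (2 ℕ.* n) ⟩
  4 ℕ.* n ℕ.+ (n ℕ.+ n) ℕ.+ 2 ℕ.* n                        ≡⟨ collect n ⟩
  n ℕ.* 8                                                  ∎)
  where
  open ℕ.≤-Reasoning
  expand : ∀ p j → (p ℕ.+ p ℕ.+ suc j) ℕ.* 8 ≡ 4 ℕ.* (p ℕ.* 4) ℕ.+ (2 ℕ.* (4 ℕ.* j ℕ.+ 2) ℕ.+ 4)
  expand = solve-∀
  collect : ∀ n → 4 ℕ.* n ℕ.+ (n ℕ.+ n) ℕ.+ 2 ℕ.* n ≡ n ℕ.* 8
  collect = solve-∀

-- `pred m / 10` is the largest L for which 10L + 1 bits fit into m slots; at most nine slots stay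
-- empty.
1+10*[pred/10]≤ : ∀ {m} → 0 ℕ.< m → suc (10 ℕ.* (ℕ.pred m ℕ./ 10)) ℕ.≤ m
1+10*[pred/10]≤ {suc m} _ = ℕ.s≤s (ℕ.≤-trans (ℕ.≤-reflexive (ℕ.*-comm 10 (m ℕ./ 10))) (ℕ.m/n*n≤m m 10))

≤10*suc[pred/10] : ∀ m → m ℕ.≤ 10 ℕ.* suc (ℕ.pred m ℕ./ 10)
≤10*suc[pred/10] zero    = ℕ.z≤n
≤10*suc[pred/10] (suc m) = begin
  suc m                                 ≡⟨ ≡.cong suc (ℕ.m≡m%n+[m/n]*n m 10) ⟩
  suc (m ℕ.% 10) ℕ.+ m ℕ./ 10 ℕ.* 10    ≤⟨ ℕ.+-monoˡ-≤ (m ℕ./ 10 ℕ.* 10) (ℕ.m%n<n m 10) ⟩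
  suc (m ℕ./ 10) ℕ.* 10                 ≡⟨ ℕ.*-comm (suc (m ℕ./ 10)) 10 ⟩
  10 ℕ.* suc (m ℕ./ 10)                 ∎
  where open ℕ.≤-Reasoning

n<2*[4n+2] : ∀ n → n ℕ.< 2 ℕ.* (4 ℕ.* n ℕ.+ 2)
n<2*[4n+2] n = begin-strict
  n                               <⟨ ℕ.m<m+n n {suc (7 ℕ.* n ℕ.+ 3)} ℕ.z<s ⟩
  n ℕ.+ suc (7 ℕ.* n ℕ.+ 3)       ≡⟨ expand n ⟩
  2 ℕ.* (4 ℕ.* n ℕ.+ 2)           ∎
  where
  open ℕ.≤-Reasoning
  expand : ∀ n → n ℕ.+ suc (7 ℕ.* n ℕ.+ 3) ≡ 2 ℕ.* (4 ℕ.* n ℕ.+ 2)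
  expand = solve-∀

-- The constant is 960 = 8 * 6 * 10 * 2: n ≤ 8p, 4k + 2 ≤ 6k with k = j + 1, pk ≤ 10(L + 1), and L +
-- 1 ≤ 2s.
size-bound : ∀ n p j L s → n ℕ.≤ 8 ℕ.* p → p ℕ.* suc j ℕ.≤ 10 ℕ.* suc L → suc L ℕ.≤ 2 ℕ.* s →
             n ℕ.* (4 ℕ.* suc j ℕ.+ 2) ℕ.≤ 960 ℕ.* s
size-bound n p j L s n≤8p pk≤10sL sL≤2s = begin
  n ℕ.* (4 ℕ.* suc j ℕ.+ 2)                ≤⟨ ℕ.*-mono-≤ n≤8p (ℕ.m≤m+n (4 ℕ.* suc j ℕ.+ 2) (2 ℕ.* j)) ⟩
  8 ℕ.* p ℕ.* (4 ℕ.* suc j ℕ.+ 2 ℕ.+ 2 ℕ.* j) ≡⟨ collect p j ⟩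
  48 ℕ.* (p ℕ.* suc j)                     ≤⟨ ℕ.*-monoʳ-≤ 48 pk≤10sL ⟩
  48 ℕ.* (10 ℕ.* suc L)                    ≡⟨ ℕ.*-assoc 48 10 (suc L) ⟨
  48 ℕ.* 10 ℕ.* suc L                      ≤⟨ ℕ.*-monoʳ-≤ (48 ℕ.* 10) sL≤2s ⟩
  48 ℕ.* 10 ℕ.* (2 ℕ.* s)                  ≡⟨ ℕ.*-assoc (48 ℕ.* 10) 2 s ⟨
  960 ℕ.* s                                ∎
  where
  open ℕ.≤-Reasoning
  collect : ∀ p j → 8 ℕ.* p ℕ.* (4 ℕ.* suc j ℕ.+ 2 ℕ.+ 2 ℕ.* j) ≡ 48 ℕ.* (p ℕ.* suc j)
  collect = solve-∀

-- Choice of k from ε, and the final bound.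

module LowerBound {a ℓ₁ ℓ₂} (ℝ : OrderedField a ℓ₁ ℓ₂) where

  open OrderedField ℝ hiding (zero)
  open FieldProperties ℝ
  open PartialOrderReasoning poset

  c : Carrier
  c = fromℕ 1 / fromℕ 960

  960>0 : 0# < fromℕ 960
  960>0 = fromℕ>0 960

  c*960≈1 : c * fromℕ 960 ≈ 1#
  c*960≈1 = trans (x/y*y≈x (fromℕ 1) 960>0) fromℕ-1

  c>0 : 0# < c
  c>0 = *-nonNegative (0≤fromℕ 1) (⁻¹-nonNegative 960>0) ,
    λ 0≈c → 0≉1 (trans (sym (zeroˡ (fromℕ 960))) (trans (*-congʳ 0≈c) c*960≈1))

  bound : ∀ {o m} (n : ℕ) .{{_ : NonZero n}} (ε : Carrier) →
    fromℕ 2 / fromℕ n ≤ ε → ε ≤ fromℕ 1 / fromℕ 2 →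
    (s : ℕ) (P : ProbabilitySpace ℝ o m) →
    let open ProbabilitySpace P in
    (sk : Ω → Graph n → List Bool) →
    (est : Ω → Subset n → List Bool → Carrier) →
    (∀ ω G → length (sk ω G) ℕ.≤ s) →
    (∀ (G : Graph n) (S : Subset n) →
    Pr[ (λ ω → est ω S (sk ω G) ∈[1± ε ] fromℕ (cutSize G S)) ]≥ (fromℕ 9 / fromℕ 10)) →
    c * fromℕ n / ε ≤ fromℕ s
  bound n ε 2/n≤ε ε≤1/2 s P sk est sk-short accurate =
    let j , ε-small , ε-large = last-true (λ j → ε * fromℕ (4 ℕ.* j ℕ.+ 2) ≤? 1#) small-0 n ¬small-n
    in conclude j ε-small ε-large
    where
    2≤εn : fromℕ 2 ≤ ε * fromℕ n
    2≤εn = x/y≤z⇒x≤z*y (fromℕ>0 n) 2/n≤ε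

    0<ε : 0# < ε
    0<ε with total ε 0#
    ... | inj₁ ε≤0 = contradiction (fromℕ-cancel 2 0 (begin
      fromℕ 2        ≤⟨ 2≤εn ⟩
      ε * fromℕ n    ≤⟨ *-monoˡ-≤ (0≤fromℕ n) ε≤0 ⟩
      0# * fromℕ n   ≈⟨ zeroˡ (fromℕ n) ⟩
      0#             ∎)) λ ()
    ... | inj₂ 0≤ε = 0≤ε , λ 0≈ε → contradiction (fromℕ-cancel 2 0 (begin
      fromℕ 2        ≤⟨ 2≤εn ⟩
      ε * fromℕ n    ≈⟨ *-congʳ 0≈ε ⟨
      0# * fromℕ n   ≈⟨ zeroˡ (fromℕ n) ⟩
      0#             ∎)) λ ()

    Small : ℕ → Set _
    Small j = ε * fromℕ (4 ℕ.* j ℕ.+ 2) ≤ 1#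

    -- Here ε ≥ 2/n turns the accuracy condition on j into room on n vertices. At j = 0 it gives n ≥
    -- 4, and at j = n it is absurd, which bounds the search for j.
    small⇒≤n : ∀ j → Small j → 2 ℕ.* (4 ℕ.* j ℕ.+ 2) ℕ.≤ n
    small⇒≤n j ε-small = fromℕ-cancel _ n (begin
      fromℕ (2 ℕ.* (4 ℕ.* j ℕ.+ 2))            ≈⟨ fromℕ-* 2 (4 ℕ.* j ℕ.+ 2) ⟩
      fromℕ 2 * fromℕ (4 ℕ.* j ℕ.+ 2)          ≤⟨ *-monoˡ-≤ (0≤fromℕ (4 ℕ.* j ℕ.+ 2)) 2≤εn ⟩
      ε * fromℕ n * fromℕ (4 ℕ.* j ℕ.+ 2)
        ≈⟨ solve 3 (λ e n f → e :* n :* f := e :* f :* n) refl ε (fromℕ n) (fromℕ (4 ℕ.* j ℕ.+ 2)) ⟩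
      ε * fromℕ (4 ℕ.* j ℕ.+ 2) * fromℕ n      ≤⟨ *-monoˡ-≤ (0≤fromℕ n) ε-small ⟩
      1# * fromℕ n                             ≈⟨ *-identityˡ (fromℕ n) ⟩
      fromℕ n                                  ∎)

    -- At j = 0 the error budget reads ε * 2 ≤ 1, exactly the hypothesis ε ≤ 1/2; the band graph is
    -- then a partial matching.
    small-0 : Small 0
    small-0 = ≤-trans (x≤z/y⇒x*y≤z (fromℕ>0 2) ε≤1/2) (≤-reflexive fromℕ-1)

    4≤n : 4 ℕ.≤ n
    4≤n = small⇒≤n 0 small-0

    ¬small-n : ¬ Small n
    ¬small-n ε-small = ℕ.<⇒≱ (n<2*[4n+2] n) (small⇒≤n n ε-small)

    -- Maximality of j supplies the converse estimate 1 ≤ ε(4k + 2), so k is at least of order 1/ε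
    -- and the bound of order nk on s becomes one of order n/ε.
    conclude : ∀ j → Small j → ¬ Small (suc j) → c * fromℕ n / ε ≤ fromℕ s
    conclude j ε-small ε-large = x≤z*y⇒x/y≤z 0<ε (begin
      c * fromℕ n                               ≈⟨ *-congˡ (*-identityʳ (fromℕ n)) ⟨
      c * (fromℕ n * 1#)                        ≤⟨ *-monoʳ-≤ (proj₁ c>0) (*-monoʳ-≤ (0≤fromℕ n) 1≤ε[4j+6]) ⟩
      c * (fromℕ n * (ε * fromℕ (4 ℕ.* suc j ℕ.+ 2)))
        ≈⟨ solve 4 (λ c n e f → c :* (n :* (e :* f)) := c :* ((n :* f) :* e)) refl c (fromℕ n) ε (fromℕ (4 ℕ.* suc j ℕ.+ 2)) ⟩
      c * ((fromℕ n * fromℕ (4 ℕ.* suc j ℕ.+ 2)) * ε)  ≈⟨ *-congˡ (*-congʳ (fromℕ-* n (4 ℕ.* suc j ℕ.+ 2))) ⟨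
      c * (fromℕ (n ℕ.* (4 ℕ.* suc j ℕ.+ 2)) * ε)
        ≤⟨ *-monoʳ-≤ (proj₁ c>0) (*-monoˡ-≤ (proj₁ 0<ε) (fromℕ-mono n[4j+6]≤960s)) ⟩
      c * (fromℕ (960 ℕ.* s) * ε)               ≈⟨ *-congˡ (*-congʳ (fromℕ-* 960 s)) ⟩
      c * ((fromℕ 960 * fromℕ s) * ε)
        ≈⟨ solve 4 (λ c x s e → c :* ((x :* s) :* e) := (c :* x) :* (s :* e)) refl c (fromℕ 960) (fromℕ s) ε ⟩
      (c * fromℕ 960) * (fromℕ s * ε)           ≈⟨ *-congʳ c*960≈1 ⟩
      1# * (fromℕ s * ε)                        ≈⟨ *-identityˡ (fromℕ s * ε) ⟩
      fromℕ s * ε                               ∎)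
      where
      p k L : ℕ
      p = n ℕ./ 4
      k = suc j
      L = ℕ.pred (p ℕ.* k) ℕ./ 10

      1≤ε[4j+6] : 1# ≤ ε * fromℕ (4 ℕ.* suc j ℕ.+ 2)
      1≤ε[4j+6] with total 1# (ε * fromℕ (4 ℕ.* suc j ℕ.+ 2))
      ... | inj₁ 1≤  = 1≤
      ... | inj₂ small = contradiction small ε-large

      0<p : 0 ℕ.< p
      0<p = ℕ.m≥n⇒m/n>0 4≤n

      0<pk : 0 ℕ.< p ℕ.* k
      0<pk = ℕ.*-mono-< 0<p (ℕ.s≤s (ℕ.z≤n {j}))

      sL≤2s : suc L ℕ.≤ 2 ℕ.* s
      sL≤2s = Decoding.sketch-bound P {n} {p} {j} {L} {s} 0<p (two-quarters+≤ n p j (ℕ.m/n*n≤m n 4) 4≤n (small⇒≤n j ε-small))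
        (1+10*[pred/10]≤ 0<pk) 0<ε ε-small sk est sk-short accurate

      n[4j+6]≤960s : n ℕ.* (4 ℕ.* suc j ℕ.+ 2) ℕ.≤ 960 ℕ.* s
      n[4j+6]≤960s = size-bound n p j L s (≤8*[/4] 4≤n) (≤10*suc[pred/10] (p ℕ.* k)) sL≤2s

theorem4p13 : ∀ {a ℓ₁ ℓ₂ o m : Level} (ℝ : OrderedField a ℓ₁ ℓ₂) →
    let open OrderedField ℝ in
    Σ[ c ∈ Carrier ] (0# < c ×
    (∀ (n : ℕ) .{{_ : NonZero n}} (ε : Carrier) →
    fromℕ 2 / fromℕ n ≤ ε → ε ≤ fromℕ 1 / fromℕ 2 →
    (s : ℕ) (P : ProbabilitySpace ℝ o m) →
    let open ProbabilitySpace P in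
    (sk : Ω → Graph n → List Bool) →
    (est : Ω → Subset n → List Bool → Carrier) →
    (∀ ω G → length (sk ω G) ℕ.≤ s) →
    (∀ (G : Graph n) (S : Subset n) →
    Pr[ (λ ω → est ω S (sk ω G) ∈[1± ε ] fromℕ (cutSize G S)) ]≥ (fromℕ 9 / fromℕ 10)) →
    c * fromℕ n / ε ≤ fromℕ s))
theorem4p13 ℝ = c , c>0 , bound
  where open LowerBound ℝ
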